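{- Let $k \ge 3$ be an integer and let $\beta^k$ be the $k$-dimensional cross polytope. The $2$-skeleton $\operatorname{skel}_2(\beta^k)$ can be decomposed into triangulated vertex transitive closed surfaces. More precisely: (a) if $k \equiv 1$ or $2 \pmod 3$, then $\operatorname{skel}_2(\beta^k)$ decomposes into $\frac{(k-1)(k-2)}{3}$ triangulated vertex transitive closed surfaces of Euler characteristic $0$, each on $2k$ vertices; (b) if $k \equiv 0 \pmod 3$, then $\operatorname{skel}_2(\beta^k)$ decomposes into $\frac{k}{3}$ disjoint copies of $\partial\beta^3$ (on $6$ vertices each) and $\frac{k(k-3)}{3}$ triangulated vertex transitive closed surfaces of Euler characteristic $0$, each on $2k$ vertices.
   Context: The $k$-dimensional cross polytope $\beta^k$ is the convex hull of the $2k$ points $(0,\ldots,0,\pm 1,0,\ldots,0)\in\mathbb{R}^k$. Combinatorially, label its vertices by $0,\ldots,2k-1$ so that the diagonals (pairs of antipodal vertices) are $\{i,k+i\}$, $0\le i\le k-1$; its boundary complex is $$\partial\beta^k=\{\langle a_1,\ldots,a_k\rangle \mid a_i\in\{0,\ldots,2k-1\},\ \{i,k+i\}\not\subseteq\{a_1,\ldots,a_k\}\ \text{for all } 0\le i\le k-1\}$$ (listing the facets, i.e. the $k$-element vertex sets containing no diagonal). The $2$-skeleton $\operatorname{skel}_2(\beta^k)$ is the set of all faces of dimension at most $2$; its triangles are the $3$-element subsets of $\{0,\ldots,2k-1\}$ containing no diagonal. In particular $\partial\beta^3$ is the boundary of the octahedron. A triangulated closed surface is a finite $2$-dimensional simplicial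 complex in which the link of every vertex is a cycle (the boundary of a polygon); it is not required to be connected. It is vertex transitive if its group of simplicial automorphisms acts transitively on its vertices. "$\operatorname{skel}_2(\beta^k)$ decomposes into" a family of surfaces means that each surface of the family is a subcomplex of $\operatorname{skel}_2(\beta^k)$ and that every triangle of $\beta^k$ belongs to exactly one surface of the family. -}

module Defs where

open import Data.Fin.Base using (Fin; toℕ; _↑ˡ_; _↑ʳ_)
open import Data.Fin.Properties as Fin using (any?; all?)
open import Data.Fin.Subset
  using (Subset; inside; outside; _∈_; _∉_; _⊆_; _⊈_; _∪_; ⁅_⁆; ∣_∣)
open import Data.Fin.Subset.Properties
  using (_∈?_; _⊆?_; anySubset?; ⊆-trans; p⊆q⇒∣p∣≤∣q∣; x∈p∪q⁻; x∈p∪q⁺)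
open import Data.Bool.Properties as Bool using ()
open import Data.Integer.Base as ℤ using (ℤ; +_; -1ℤ; 0ℤ)
open import Data.List.Base as List using (List; []; _∷_; _++_; filter; foldr; length; upTo)
open import Data.Nat.Base using (ℕ; zero; suc; _+_; _≤_; NonZero)
open import Data.Nat.DivMod using (_mod_)
open import Data.Nat.Properties as ℕ using ()
open import Data.Product using (Σ; ∃; ∃!; _×_; _,_)
open import Data.Sum.Base as Sum using ()
open import Data.Vec.Base using ([]; _∷_; tabulate)
open import Data.Vec.Properties using (≡-dec)
open import Function.Base using (id)
open import Level using (0ℓ)
open import Relation.Binary.PropositionalEquality using (_≡_)
open import Relation.Nullary using (¬_; does; ¬?; _×-dec_)
open import Relation.Unary using (Pred; Decidable)

-- A complex on the labels 0, …, n - 1.  Not every label has to be a vertex: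
-- v is a vertex precisely when ⁅ v ⁆ is a face.
record SimplicialComplex (n : ℕ) : Set₁ where
  field
    Face        : Pred (Subset n) 0ℓ
    Face?       : Decidable Face
    down-closed : ∀ {F G} → F ⊆ G → Face G → Face F

  IsVertex : Pred (Fin n) 0ℓ
  IsVertex v = Face ⁅ v ⁆

open SimplicialComplex public

_≤ᶜ_ : ∀ {n} → SimplicialComplex n → SimplicialComplex n → Set
K ≤ᶜ L = ∀ F → Face K F → Face L F

HasDimension : ∀ {n} → SimplicialComplex n → ℕ → Set
HasDimension K d =
  (∃ λ F → Face K F × ∣ F ∣ ≡ suc d) × (∀ F → Face K F → ∣ F ∣ ≤ suc d)

generatedBy : ∀ {n} {P : Pred (Subset n) 0ℓ} → Decidable P → SimplicialComplex n
generatedBy {P = P} P? = record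
  { Face        = λ F → ∃ λ G → P G × F ⊆ G
  ; Face?       = λ F → anySubset? (λ G → P? G ×-dec F ⊆? G)
  ; down-closed = λ { F⊆G (H , PH , G⊆H) → H , PH , ⊆-trans F⊆G G⊆H }
  }

skeleton : ∀ {n} → ℕ → SimplicialComplex n → SimplicialComplex n
skeleton d K = record
  { Face        = λ F → Face K F × ∣ F ∣ ≤ suc d
  ; Face?       = λ F → Face? K F ×-dec ∣ F ∣ ℕ.≤? suc d
  ; down-closed = λ { F⊆G (KG , ∣G∣≤) →
      down-closed K F⊆G KG , ℕ.≤-trans (p⊆q⇒∣p∣≤∣q∣ F⊆G) ∣G∣≤ }
  }

link : ∀ {n} → SimplicialComplex n → Fin n → SimplicialComplex n
link K v = record
  { Face        = λ F → v ∉ F × Face K (⁅ v ⁆ ∪ F)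
  ; Face?       = λ F → ¬? (v ∈? F) ×-dec Face? K (⁅ v ⁆ ∪ F)
  ; down-closed = λ { F⊆G (v∉G , KvG) →
      (λ v∈F → v∉G (F⊆G v∈F)) ,
      down-closed K (λ x∈ → x∈p∪q⁺ (Sum.map id F⊆G (x∈p∪q⁻ _ _ x∈))) KvG }
  }

image : ∀ {m n} → (Fin m → Fin n) → Subset m → Subset n
image f F = tabulate λ w → does (any? λ v → v ∈? F ×-dec f v Fin.≟ w)

-- Simplicial isomorphism.  The values of to and from at labels that are not
-- vertices are irrelevant.
record _≅_ {m n : ℕ} (K : SimplicialComplex m) (L : SimplicialComplex n) : Set where
  field
    to        : Fin m → Fin n
    from      : Fin n → Fin m
    to-face   : ∀ F → Face K F → Face L (image to F)
    from-face : ∀ F → Face L F → Face K (image from F)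
    from∘to   : ∀ v → IsVertex K v → from (to v) ≡ v
    to∘from   : ∀ w → IsVertex L w → to (from w) ≡ w

VertexTransitive : ∀ {n} → SimplicialComplex n → Set
VertexTransitive K =
  ∀ v w → IsVertex K v → IsVertex K w → Σ (K ≅ K) λ φ → _≅_.to φ v ≡ w

-- The boundary of an m-gon (for m ≥ 3).
∂polygon : (m : ℕ) .{{_ : NonZero m}} → SimplicialComplex m
∂polygon m = generatedBy {P = λ E → ∃ λ i → E ≡ ⁅ i ⁆ ∪ ⁅ suc (toℕ i) mod m ⁆}
  λ E → any? λ i → ≡-dec Bool._≟_ E (⁅ i ⁆ ∪ ⁅ suc (toℕ i) mod m ⁆)

IsCycle : ∀ {n} → SimplicialComplex n → Set
IsCycle K = ∃ λ m → K ≅ ∂polygon (3 + m)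

IsClosedSurface : ∀ {n} → SimplicialComplex n → Set
IsClosedSurface K = HasDimension K 2 × (∀ v → IsVertex K v → IsCycle (link K v))

allSubsets : ∀ n → List (Subset n)
allSubsets zero    = [] ∷ []
allSubsets (suc n) =
  List.map (inside ∷_) (allSubsets n) ++ List.map (outside ∷_) (allSubsets n)

-- The number of d-dimensional faces.
#faces : ∀ {n} → ℕ → SimplicialComplex n → ℕ
#faces {n} d K =
  length (filter (λ F → Face? K F ×-dec ∣ F ∣ ℕ.≟ suc d) (allSubsets n))

#vertices : ∀ {n} → SimplicialComplex n → ℕ
#vertices = #faces 0

-- Faces have at most n elements, so summing over d < n covers all dimensions.
χ : ∀ {n} → SimplicialComplex n → ℤ
χ {n} K = foldr ℤ._+_ 0ℤ (List.map (λ d → -1ℤ ℤ.^ d ℤ.* + #faces d K) (upTo n))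

-- For i : Fin k, the labels i ↑ˡ k and k ↑ʳ i are i and k + i.
diagonal : ∀ {k} → Fin k → Subset (k + k)
diagonal {k} i = ⁅ i ↑ˡ k ⁆ ∪ ⁅ k ↑ʳ i ⁆

∂β : (k : ℕ) → SimplicialComplex (k + k)
∂β k = generatedBy {P = λ F → ∣ F ∣ ≡ k × (∀ i → diagonal {k} i ⊈ F)}
  λ F → ∣ F ∣ ℕ.≟ k ×-dec all? λ i → ¬? (diagonal {k} i ⊆? F)

-- The faces of β k of dimension at most 2.  For k ≥ 3 all of them are proper,
-- hence lie in the boundary complex.
skel₂β : (k : ℕ) → SimplicialComplex (k + k)
skel₂β k = skeleton 2 (∂β k)

DecomposesInto : ∀ {n} {I : Set} → SimplicialComplex n → (I → SimplicialComplex n) → Set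
DecomposesInto K S =
  (∀ i → S i ≤ᶜ K) ×
  (∀ F → Face K F → ∣ F ∣ ≡ 3 → ∃! _≡_ λ i → Face (S i) F)

VertexDisjoint : ∀ {n} {I : Set} → (I → SimplicialComplex n) → Set
VertexDisjoint S = ∀ i j → ¬ (i ≡ j) → ∀ v → IsVertex (S i) v → ¬ IsVertex (S j) v

{-# OPTIONS --safe #-}
module Submission where

-- Identify the labels with ℤ/2k, so that antipodes differ by κ = k, and record a
-- triangle {u , u + x , u + y} seen from u as the pair (x , y).  Across its edge
-- {u , u + y} place the triangle obtained by reflecting u + x in the midpoint of the
-- edge: seen from u, this is the rotation ρ (x , y) = (y , y - x).  When y = 2x the
-- reflection fixes u + x, and the antipode of u + x is taken instead.  The rotation has
-- order 6 on all pairs that span a triangle with 0, except those with 6x = 6y = 0.  The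
-- translates of the triangles {0 , x , y}, with (x , y) in one orbit, therefore form a
-- surface on 2k vertices of degree 6, so χ = 0, and the translations act transitively
-- on it.  Pairs with 6x = 6y = 0 occur only if 3 ∣ k; there ρ has order 4, and its
-- orbit gives octahedra on the cosets of the subgroup of order 6.  Of the
-- (2k - 2)(2k - 4) pairs every hexagon uses 12 and the octahedra use 8, which gives the
-- number of surfaces.

open import Defs
open import Algebra.Bundles using (CommutativeMonoid)
open import Algebra.Core using (Op₁; Op₂)
open import Algebra.Structures using (IsAbelianGroup)
open import Data.Bool.Base using (Bool; true; false; if_then_else_)
open import Data.Bool.Properties as Bool using ()
open import Data.Empty using (⊥-elim)
open import Data.Fin.Base as Fin
  using (Fin; zero; suc; toℕ; fromℕ<; _↑ˡ_; _↑ʳ_; splitAt; join)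
open import Data.Fin.Patterns
import Data.Fin.Properties as Fin
open import Data.Fin.Subset
  using (Subset; inside; outside; _∈_; _∉_; _⊆_; _⊈_; _∪_; ⁅_⁆; ∣_∣; ⋃; ∁)
open import Data.Fin.Subset.Properties
  using (⊆-antisym; ⊆-trans; x∈⁅x⁆; x∈⁅y⁆⇒x≡y; x∈p∪q⁺; x∈p∪q⁻; ∉⊥; _∈?_; p⊂q⇒∣p∣<∣q∣;
         p⊆q⇒∣p∣≤∣q∣; ∣∁p∣≡n∸∣p∣; x∉p⇒x∈∁p; x∈p⇒x∉∁p; ∣p∣≤n)
open import Data.Integer.Base as ℤ using (ℤ; 0ℤ; -1ℤ)
import Data.Integer.Properties as ℤ
import Data.Integer.Solver as ℤ
open import Data.List.Base as List
  using (List; []; _∷_; _++_; length; concatMap; filter; allFin; tabulate; cartesianProduct; applyUpTo)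
open import Data.List.Membership.Propositional using () renaming (_∈_ to _∈ˡ_; _∉_ to _∉ˡ_)
open import Data.List.Membership.Propositional.Properties
  using (∈-map⁺; ∈-map⁻; ∈-++⁺ˡ; ∈-++⁺ʳ; ∈-++⁻; ∈-concatMap⁺; ∈-∃++; ∈-allFin; ∈-lookup;
         ∈-filter⁺; ∈-filter⁻; ∈-tabulate⁺; ∈-tabulate⁻; ∈-cartesianProduct⁺)
import Data.List.Membership.DecPropositional as DecMembership
open import Data.List.Properties using (length-map; length-++; length-tabulate; filter-none)
open import Data.List.Relation.Unary.All as All using (All; []; _∷_)
open import Data.List.Relation.Unary.All.Properties using (¬Any⇒All¬)
open import Data.List.Relation.Unary.AllPairs using (AllPairs; []; _∷_)
open import Data.List.Relation.Unary.Any as Any using (Any; here; there)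
open import Data.List.Relation.Unary.Any.Properties using (lookup-index)
open import Data.List.Relation.Unary.Unique.Propositional using (Unique)
import Data.List.Relation.Unary.Unique.Propositional.Properties as Unique
open import Data.Nat.Base as ℕ
  using (ℕ; zero; suc; NonZero; z≤n; s≤s; _+_; _*_; _∸_; _≤_; _<_; _/_; _%_)
open import Data.Nat.DivMod
  using (_mod_; m%n<n; m≡m%n+[m/n]*n; m<n⇒m%n≡m; n%n≡0; %-distribˡ-+; %-remove-+ʳ; m∣n⇒o%n%m≡o%m;
         %-congˡ; m*n/n≡m)
open import Data.Nat.Divisibility using (_∣_; divides; ∣⇒≤; ∣-refl; n∣m*n; m%n≡0⇒n∣m; n∣m⇒m%n≡0)
open import Data.Nat.GeneralisedArithmetic using (fold; fold-+)
open import Data.Nat.Primality using (prime?; euclidsLemma)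
import Data.Nat.Properties as ℕ
open import Data.Nat.Solver using (module +-*-Solver)
open import Data.Product using (∃!)
open import Data.Product.Base using (Σ; ∃; ∃-syntax; _×_; _,_; proj₁; proj₂; swap)
import Data.Product.Properties as Product
open import Data.Sum.Base as Sum using (_⊎_; inj₁; inj₂; [_,_])
open import Data.Unit.Base using (⊤; tt)
open import Data.Vec.Base as Vec using (Vec; []; _∷_)
open import Data.Vec.Properties
  using (≡-dec; lookup∘tabulate; []=⇒lookup; lookup⇒[]=; lookup-++ˡ; lookup-++ʳ)
open import Function.Base using (_∘_; id)
open import Level using (0ℓ)
open import Relation.Binary.Definitions using (DecidableEquality; tri<; tri≈; tri>)
open import Relation.Binary.PropositionalEquality hiding ([_])
open import Relation.Nullary using (¬_; Dec; yes; no; does; contradiction; ¬?; _×-dec_; _⊎-dec_; _→-dec_)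
open import Relation.Nullary.Decidable
  using (True; False; toWitness; toWitnessFalse; from-yes; map′)
open import Relation.Unary using (Pred; Decidable)

-- A triangle is recorded by six pairs: three base vertices, two orders. An orbit defines a surface
-- only if it is blind to this choice, so it has to be closed under `swap` and under the change of
-- base vertex (x , y) ↦ (- x , y - x). Generically that change is `swap` after two rotations, which
-- is why a single rule for crossing edges fixes the links at all vertices consistently. The
-- obstacle is the shape y = 2x: plain reflection would make both triangles at the edge {u , u + y}
-- coincide, and the substitute makes the rotation nonlinear. The antipode is a consistent
-- substitute because x and x + κ have the same double, so crossing an edge stays an involution.
-- Only orbits meeting (x , 2x), (2y , y) or (x , - x) are affected: three steps lead from (x , 2x)
-- to (w , 2w) with w = - (x + κ), and x ↦ w is an involution, so the period is again 6 unless 3x is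
-- 0 or κ. That exception is 6x = 0; there two antipodal steps follow each other, and the cycle
-- closes after four.

private variable
  A B : Set
  m : ℕ

-- Double counting of incident pairs

unique-⊆⇒length≤ : {xs ys : List A} → Unique xs → (∀ {x} → x ∈ˡ xs → x ∈ˡ ys) → length xs ≤ length ys
unique-⊆⇒length≤ [] _ = z≤n
unique-⊆⇒length≤ {xs = x ∷ xs} (x∉ ∷ u) sub with ∈-∃++ (sub (here refl))
... | as , bs , refl = ℕ.≤-trans (s≤s (unique-⊆⇒length≤ u sub′))
      (ℕ.≤-reflexive (trans (cong suc (length-++ as)) (trans (sym (ℕ.+-suc (length as) _)) (sym (length-++ as)))))
  where
  sub′ : ∀ {y} → y ∈ˡ xs → y ∈ˡ as ++ bs
  sub′ {y} y∈ with ∈-++⁻ as (sub (there y∈))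
  ... | inj₁ p = ∈-++⁺ˡ p
  ... | inj₂ (here refl) = contradiction refl (All.lookup x∉ y∈)
  ... | inj₂ (there p) = ∈-++⁺ʳ as p

unique-length : {xs ys : List A} → Unique xs → Unique ys →
  (∀ {x} → x ∈ˡ xs → x ∈ˡ ys) → (∀ {x} → x ∈ˡ ys → x ∈ˡ xs) → length xs ≡ length ys
unique-length u v f g = ℕ.≤-antisym (unique-⊆⇒length≤ u f) (unique-⊆⇒length≤ v g)

length-concatMap : ∀ (f : A → List B) xs {c} → (∀ {x} → x ∈ˡ xs → length (f x) ≡ c) →
  length (concatMap f xs) ≡ length xs * c
length-concatMap f [] eq = refl
length-concatMap f (x ∷ xs) eq = trans (length-++ (f x)) (cong₂ _+_ (eq (here refl)) (length-concatMap f xs (eq ∘ there)))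

module Incidence (f : A → List B) where

  flags : List A → List (A × B)
  flags = concatMap (λ a → List.map (a ,_) (f a))

  ∈-flags⁺ : ∀ {xs a b} → a ∈ˡ xs → b ∈ˡ f a → (a , b) ∈ˡ flags xs
  ∈-flags⁺ a∈ b∈ = ∈-concatMap⁺ _ (Any.map (λ { refl → ∈-map⁺ _ b∈ }) a∈)

  ∈-flags⁻ : ∀ xs {a b} → (a , b) ∈ˡ flags xs → a ∈ˡ xs × b ∈ˡ f a
  ∈-flags⁻ (x ∷ xs) p with ∈-++⁻ (List.map (x ,_) (f x)) p
  ... | inj₁ q with _ , b∈ , refl ← ∈-map⁻ _ q = here refl , b∈
  ... | inj₂ q with a∈ , b∈ ← ∈-flags⁻ xs q = there a∈ , b∈

  flags-unique : ∀ {xs} → Unique xs → (∀ {a} → a ∈ˡ xs → Unique (f a)) → Unique (flags xs)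
  flags-unique [] _ = []
  flags-unique {xs = x ∷ xs} (x∉ ∷ u) v =
    Unique.++⁺ (Unique.map⁺ (λ { refl → refl }) (v (here refl))) (flags-unique u (v ∘ there))
      λ { (p , q) → disjoint p q }
    where
    disjoint : ∀ {z} → z ∈ˡ List.map (x ,_) (f x) → ¬ z ∈ˡ flags xs
    disjoint p q with _ , _ , refl ← ∈-map⁻ _ p =
      All.lookup x∉ (proj₁ (∈-flags⁻ xs q)) refl

  length-flags : ∀ xs {c} → (∀ {a} → a ∈ˡ xs → length (f a) ≡ c) → length (flags xs) ≡ length xs * c
  length-flags xs eq = length-concatMap _ xs λ {a} a∈ → trans (length-map (a ,_) (f a)) (eq a∈)

open Incidence

-- Each side counts the incident pairs, grouped by one of the two components; `fg` and `gf` say that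
-- both groupings list the same pairs.
double-counting : {xs : List A} {ys : List B} (f : A → List B) (g : B → List A) {a b : ℕ} →
  Unique xs → Unique ys →
  (∀ {x} → x ∈ˡ xs → Unique (f x)) → (∀ {y} → y ∈ˡ ys → Unique (g y)) →
  (∀ {x y} → x ∈ˡ xs → y ∈ˡ f x → y ∈ˡ ys × x ∈ˡ g y) →
  (∀ {x y} → y ∈ˡ ys → x ∈ˡ g y → x ∈ˡ xs × y ∈ˡ f x) →
  (∀ {x} → x ∈ˡ xs → length (f x) ≡ a) → (∀ {y} → y ∈ˡ ys → length (g y) ≡ b) →
  length xs * a ≡ length ys * b
double-counting {xs = xs} {ys} f g uxs uys uf ug fg gf lf lg = begin
  length xs * _                        ≡⟨ length-flags f xs lf ⟨
  length (flags f xs)                  ≡⟨ length-map swap (flags f xs) ⟨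
  length (List.map swap (flags f xs))  ≡⟨ unique-length (Unique.map⁺ (λ { refl → refl }) (flags-unique f uxs uf))
                                           (flags-unique g uys ug) to from ⟩
  length (flags g ys)                  ≡⟨ length-flags g ys lg ⟩
  length ys * _                        ∎
  where
  open ≡-Reasoning
  to : ∀ {z} → z ∈ˡ List.map swap (flags f xs) → z ∈ˡ flags g ys
  to p with _ , q , refl ← ∈-map⁻ _ p =
    let x∈ , y∈ = ∈-flags⁻ f xs q in let y∈ys , x∈g = fg x∈ y∈ in ∈-flags⁺ g y∈ys x∈g
  from : ∀ {z} → z ∈ˡ flags g ys → z ∈ˡ List.map swap (flags f xs)
  from p = let y∈ , x∈ = ∈-flags⁻ g ys p in let x∈xs , y∈f = gf y∈ x∈ in
    ∈-map⁺ swap (∈-flags⁺ f x∈xs y∈f)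

-- Subsets as duplicate-free lists

elements : Subset m → List (Fin m)
elements []            = []
elements (inside ∷ F)  = zero ∷ List.map suc (elements F)
elements (outside ∷ F) = List.map suc (elements F)

length-elements : (F : Subset m) → length (elements F) ≡ ∣ F ∣
length-elements []            = refl
length-elements (inside ∷ F)  = cong suc (trans (length-map suc (elements F)) (length-elements F))
length-elements (outside ∷ F) = trans (length-map suc (elements F)) (length-elements F)

∈-elements⁺ : {F : Subset m} {x : Fin m} → x ∈ F → x ∈ˡ elements F
∈-elements⁺ Vec.here = here refl
∈-elements⁺ {F = inside ∷ F}  (Vec.there p) = there (∈-map⁺ suc (∈-elements⁺ p))
∈-elements⁺ {F = outside ∷ F} (Vec.there p) = ∈-map⁺ suc (∈-elements⁺ p)

∈-elements⁻ : {F : Subset m} {x : Fin m} → x ∈ˡ elements F → x ∈ F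
∈-elements⁻ {F = inside ∷ F} (here refl) = Vec.here
∈-elements⁻ {F = inside ∷ F} (there p) with _ , q , refl ← ∈-map⁻ suc p = Vec.there (∈-elements⁻ q)
∈-elements⁻ {F = outside ∷ F} p with _ , q , refl ← ∈-map⁻ suc p = Vec.there (∈-elements⁻ q)

elements-unique : (F : Subset m) → Unique (elements F)
elements-unique [] = []
elements-unique (inside ∷ F) =
  All.tabulate (λ p → λ { refl → zero∉ {xs = elements F} p }) ∷ Unique.map⁺ Fin.suc-injective (elements-unique F)
  where
  zero∉ : ∀ {k} {xs : List (Fin k)} → zero ∉ˡ List.map Fin.suc xs
  zero∉ p with _ , _ , () ← ∈-map⁻ Fin.suc p
elements-unique (outside ∷ F) = Unique.map⁺ Fin.suc-injective (elements-unique F)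

abstract
  -- Opaque: outside this block a set is known only through the two membership lemmas, never as a
  -- union of singletons.
  setOf : List (Fin m) → Subset m
  setOf xs = ⋃ (List.map ⁅_⁆ xs)

  ∈-setOf⁺ : {xs : List (Fin m)} {x : Fin m} → x ∈ˡ xs → x ∈ setOf xs
  ∈-setOf⁺ (here refl) = x∈p∪q⁺ (inj₁ (x∈⁅x⁆ _))
  ∈-setOf⁺ (there p)   = x∈p∪q⁺ (inj₂ (∈-setOf⁺ p))

  ∈-setOf⁻ : (xs : List (Fin m)) {x : Fin m} → x ∈ setOf xs → x ∈ˡ xs
  ∈-setOf⁻ []       p = contradiction p ∉⊥
  ∈-setOf⁻ (y ∷ ys) p with x∈p∪q⁻ ⁅ y ⁆ (setOf ys) p
  ... | inj₁ q = here (x∈⁅y⁆⇒x≡y y q)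
  ... | inj₂ q = there (∈-setOf⁻ ys q)

setOf-mono : {xs ys : List (Fin m)} → (∀ {x} → x ∈ˡ xs → x ∈ˡ ys) → setOf xs ⊆ setOf ys
setOf-mono {xs = xs} sub p = ∈-setOf⁺ (sub (∈-setOf⁻ xs p))

∣setOf∣ : {xs : List (Fin m)} → Unique xs → ∣ setOf xs ∣ ≡ length xs
∣setOf∣ {xs = xs} u = trans (sym (length-elements (setOf xs)))
  (unique-length (elements-unique (setOf xs)) u (∈-setOf⁻ xs ∘ ∈-elements⁻) (∈-elements⁺ ∘ ∈-setOf⁺))

setOf-elements : (F : Subset m) → F ≡ setOf (elements F)
setOf-elements F = ⊆-antisym (∈-setOf⁺ ∘ ∈-elements⁺) (∈-elements⁻ ∘ ∈-setOf⁻ (elements F))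

allSubsets-complete : (F : Subset m) → F ∈ˡ allSubsets m
allSubsets-complete [] = here refl
allSubsets-complete (inside ∷ F)  = ∈-++⁺ˡ (∈-map⁺ _ (allSubsets-complete F))
allSubsets-complete (outside ∷ F) = ∈-++⁺ʳ _ (∈-map⁺ _ (allSubsets-complete F))

allSubsets-unique : ∀ m → Unique (allSubsets m)
allSubsets-unique zero    = [] ∷ []
allSubsets-unique (suc m) = Unique.++⁺
  (Unique.map⁺ (λ { refl → refl }) (allSubsets-unique m))
  (Unique.map⁺ (λ { refl → refl }) (allSubsets-unique m))
  λ { (p , q) → disjoint p q }
  where
  disjoint : ∀ {F} → F ∈ˡ List.map (inside ∷_) (allSubsets m) → ¬ F ∈ˡ List.map (outside ∷_) (allSubsets m)
  disjoint p q with _ , _ , refl ← ∈-map⁻ _ p with _ , _ , () ← ∈-map⁻ _ q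

-- Counting the faces of a complex

module Faces (K : SimplicialComplex m) (d : ℕ) where
  faces : List (Subset m)
  faces = filter (λ F → Face? K F ×-dec ∣ F ∣ ℕ.≟ suc d) (allSubsets m)

  ∈-faces⁺ : ∀ {F} → Face K F → ∣ F ∣ ≡ suc d → F ∈ˡ faces
  ∈-faces⁺ face eq = ∈-filter⁺ _ (allSubsets-complete _) (face , eq)

  ∈-faces⁻ : ∀ {F} → F ∈ˡ faces → Face K F × ∣ F ∣ ≡ suc d
  ∈-faces⁻ p = proj₂ (∈-filter⁻ (λ F → Face? K F ×-dec ∣ F ∣ ℕ.≟ suc d) {xs = allSubsets m} p)

  faces-unique : Unique faces
  faces-unique = Unique.filter⁺ _ (allSubsets-unique m)

-- Both sides count the incident pairs (vertex, face).
#faces-regular : (K : SimplicialComplex m) (d : ℕ) (vs : List (Fin m)) (star : Fin m → List (Subset m)) {c : ℕ} →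
  Unique vs → (∀ {v} → v ∈ˡ vs → Unique (star v)) →
  (∀ {v F} → Face K F → ∣ F ∣ ≡ suc d → v ∈ F → v ∈ˡ vs × F ∈ˡ star v) →
  (∀ {v F} → v ∈ˡ vs → F ∈ˡ star v → (Face K F × ∣ F ∣ ≡ suc d) × v ∈ F) →
  (∀ {v} → v ∈ˡ vs → length (star v) ≡ c) →
  #faces d K * suc d ≡ length vs * c
#faces-regular K d vs star uvs us to from ls =
  double-counting elements star faces-unique uvs
    (λ {F} _ → elements-unique F) us
    (λ F∈ v∈ → let face , eq = ∈-faces⁻ F∈ in to face eq (∈-elements⁻ v∈))
    (λ v∈ F∈ → let (face , eq) , v∈F = from v∈ F∈ in ∈-faces⁺ face eq , ∈-elements⁺ v∈F)
    (λ {F} F∈ → trans (length-elements F) (proj₂ (∈-faces⁻ F∈)))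
    ls
  where open Faces K d

-- Deciding linear equations in an abelian group

module AbelianGroupSolver {A : Set} {_⊕_ : Op₂ A} {𝟎 : A} {⊖_ : Op₁ A}
                          (isAbelianGroup : IsAbelianGroup _≡_ _⊕_ 𝟎 ⊖_) where
  open IsAbelianGroup isAbelianGroup using (isCommutativeMonoid; assoc; comm; identityˡ; identityʳ; inverseʳ)

  private
    M : CommutativeMonoid _ _
    M = record { isCommutativeMonoid = isCommutativeMonoid }

  open import Algebra.Properties.CommutativeSemigroup (CommutativeMonoid.commutativeSemigroup M) using (interchange)
  import Algebra.Solver.CommutativeMonoid.Normal M as CM

  infixl 6 _:+_ _:-_
  infix  8 :-_

  data Term (m : ℕ) : Set where
    v    : Fin m → Term m
    :0   : Term m
    _:+_ : Term m → Term m → Term m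
    :-_  : Term m → Term m

  _:-_ : ∀ {m} → Term m → Term m → Term m
  s :- t = s :+ (:- t)

  ⟦_⟧ : ∀ {m} → Term m → Vec A m → A
  ⟦ v i ⟧    ρ = Vec.lookup ρ i
  ⟦ :0 ⟧     ρ = 𝟎
  ⟦ s :+ t ⟧ ρ = ⟦ s ⟧ ρ ⊕ ⟦ t ⟧ ρ
  ⟦ :- t ⟧   ρ = ⊖ ⟦ t ⟧ ρ

  -- A term is treated as a formal difference `pos t` minus `neg t` of expressions without inverses,
  -- as in the Grothendieck construction; negation exchanges the two.
  pos neg : ∀ {m} → Term m → CM.Expr m
  pos (v i)    = CM.var i
  pos :0       = CM.id
  pos (s :+ t) = pos s CM.⊕ pos t
  pos (:- t)   = neg t
  neg (v i)    = CM.id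
  neg :0       = CM.id
  neg (s :+ t) = neg s CM.⊕ neg t
  neg (:- t)   = pos t

  cancelʳ : ∀ {x y} z → x ⊕ z ≡ y ⊕ z → x ≡ y
  cancelʳ {x} {y} z eq = trans (undo x) (trans (cong (_⊕ (⊖ z)) eq) (sym (undo y)))
    where
    undo : ∀ w → w ≡ (w ⊕ z) ⊕ (⊖ z)
    undo w = sym (trans (assoc w z _) (trans (cong (w ⊕_) (inverseʳ z)) (identityʳ w)))

  pos-neg : ∀ {m} (t : Term m) ρ → ⟦ t ⟧ ρ ⊕ CM.⟦ neg t ⟧ ρ ≡ CM.⟦ pos t ⟧ ρ
  pos-neg (v i)    ρ = identityʳ _
  pos-neg :0       ρ = identityʳ _
  pos-neg (s :+ t) ρ = trans (interchange _ _ _ _) (cong₂ _⊕_ (pos-neg s ρ) (pos-neg t ρ))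
  pos-neg (:- t)   ρ = trans (cong ((⊖ ⟦ t ⟧ ρ) ⊕_) (sym (pos-neg t ρ)))
    (trans (sym (assoc _ _ _))
      (trans (cong (_⊕ CM.⟦ neg t ⟧ ρ) (trans (comm _ _) (inverseʳ _))) (identityˡ _)))

  -- After adding `neg s` and `neg t` to both sides no inverses remain, and the normal forms of
  -- commutative monoid expressions decide the rest.
  prove : ∀ {m} (s t : Term m) (ρ : Vec A m) →
    {True (CM.normalise (pos s CM.⊕ neg t) CM.≟ CM.normalise (pos t CM.⊕ neg s))} →
    ⟦ s ⟧ ρ ≡ ⟦ t ⟧ ρ
  prove s t ρ {eq} = cancelʳ (CM.⟦ neg s ⟧ ρ ⊕ CM.⟦ neg t ⟧ ρ) (begin
    ⟦ s ⟧ ρ ⊕ (CM.⟦ neg s ⟧ ρ ⊕ CM.⟦ neg t ⟧ ρ)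
      ≡⟨ assoc _ _ _ ⟨
    (⟦ s ⟧ ρ ⊕ CM.⟦ neg s ⟧ ρ) ⊕ CM.⟦ neg t ⟧ ρ
      ≡⟨ cong (_⊕ CM.⟦ neg t ⟧ ρ) (pos-neg s ρ) ⟩
    CM.⟦ pos s CM.⊕ neg t ⟧ ρ
      ≡⟨ CM.correct (pos s CM.⊕ neg t) ρ ⟨
    CM.⟦ CM.normalise (pos s CM.⊕ neg t) ⟧⇓ ρ
      ≡⟨ cong (λ e → CM.⟦ e ⟧⇓ ρ) (toWitness eq) ⟩
    CM.⟦ CM.normalise (pos t CM.⊕ neg s) ⟧⇓ ρ
      ≡⟨ CM.correct (pos t CM.⊕ neg s) ρ ⟩
    CM.⟦ pos t CM.⊕ neg s ⟧ ρ
      ≡⟨ cong (_⊕ CM.⟦ neg s ⟧ ρ) (pos-neg t ρ) ⟨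
    (⟦ t ⟧ ρ ⊕ CM.⟦ neg t ⟧ ρ) ⊕ CM.⟦ neg s ⟧ ρ
      ≡⟨ assoc _ _ _ ⟩
    ⟦ t ⟧ ρ ⊕ (CM.⟦ neg t ⟧ ρ ⊕ CM.⟦ neg s ⟧ ρ)
      ≡⟨ cong (⟦ t ⟧ ρ ⊕_) (comm _ _) ⟩
    ⟦ t ⟧ ρ ⊕ (CM.⟦ neg s ⟧ ρ ⊕ CM.⟦ neg t ⟧ ρ) ∎)
    where open ≡-Reasoning

  -- An equation follows from l ≡ r when the differences of the two sides agree.
  prove-from : ∀ {m} (s t l r : Term m) (ρ : Vec A m) →
    {True (CM.normalise (pos (s :+ r) CM.⊕ neg (t :+ l)) CM.≟ CM.normalise (pos (t :+ l) CM.⊕ neg (s :+ r)))} →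
    ⟦ l ⟧ ρ ≡ ⟦ r ⟧ ρ → ⟦ s ⟧ ρ ≡ ⟦ t ⟧ ρ
  prove-from s t l r ρ {eq} l≡r =
    cancelʳ (⟦ r ⟧ ρ) (trans (prove (s :+ r) (t :+ l) ρ {eq}) (cong (⟦ t ⟧ ρ ⊕_) l≡r))

-- Iterating a map with a known period

next : ∀ {m} .{{_ : NonZero m}} → Fin m → Fin m
next {m} j = suc (toℕ j) mod m

fold-suc : ∀ {A : Set} (z : A) (s : A → A) n → fold (s z) s n ≡ s (fold z s n)
fold-suc z s zero    = refl
fold-suc z s (suc n) = cong s (fold-suc z s n)

module _ {A : Set} (s : A → A) (m : ℕ) .{{_ : NonZero m}} {z : A} (period : fold z s m ≡ z) where

  fold-%  : ∀ i → fold z s (i % m) ≡ fold z s i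
  fold-% i = sym (begin
    fold z s i                                 ≡⟨ cong (fold z s) (m≡m%n+[m/n]*n i m) ⟩
    fold z s (i % m + i / m * m)           ≡⟨ fold-+ z s (i % m) ⟩
    fold (fold z s (i / m * m)) s (i % m)    ≡⟨ cong (λ w → fold w s (i % m)) (turns (i / m)) ⟩
    fold z s (i % m)                           ∎)
    where
    open ≡-Reasoning
    turns : ∀ q → fold z s (q * m) ≡ z
    turns zero    = refl
    turns (suc q) = trans (fold-+ z s m) (trans (cong (λ w → fold w s m) (turns q)) period)

  fold-mod : ∀ i → fold z s (toℕ (i mod m)) ≡ fold z s i
  fold-mod i = trans (cong (fold z s) (Fin.toℕ-fromℕ< (m%n<n i m))) (fold-% i)

-- The rotation on pairs and its period

-- A triangle {u , u + x , u + y} is recorded, as seen from its vertex u, by the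
-- pair (x , y).
module Rotation {A : Set} {_⊕_ : Op₂ A} {𝟎 : A} {⊖_ : Op₁ A}
                (isAbelianGroup : IsAbelianGroup _≡_ _⊕_ 𝟎 ⊖_) (_≟_ : DecidableEquality A)
                (κ : A) (κ⊕κ≡𝟎 : κ ⊕ κ ≡ 𝟎) where
  open AbelianGroupSolver isAbelianGroup

  private
    ⟨0⟩ ⟨1⟩ ⟨2⟩ : ∀ {m} → Term (3 + m)
    ⟨0⟩ = v 0F
    ⟨1⟩ = v 1F
    ⟨2⟩ = v 2F

  infixl 6 _─_
  _─_ : A → A → A
  x ─ y = x ⊕ (⊖ y)

  -- The third vertex of the other triangle of the surface on the edge {u , u + y}:
  -- the reflection of u + x in the midpoint of that edge, or the antipode of u + x
  -- when the reflection fixes u + x.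
  abstract
    apex : A → A → A
    apex x y with y ≟ (x ⊕ x)
    ... | yes _ = x ⊕ κ
    ... | no  _ = y ─ x

    apex-double : ∀ {x y} → y ≡ x ⊕ x → apex x y ≡ x ⊕ κ
    apex-double {x} {y} eq with y ≟ (x ⊕ x)
    ... | yes _   = refl
    ... | no  neq = contradiction eq neq

    apex-generic : ∀ {x y} → y ≢ x ⊕ x → apex x y ≡ y ─ x
    apex-generic {x} {y} neq with y ≟ (x ⊕ x)
    ... | yes eq = contradiction eq neq
    ... | no  _  = refl

    apex-cases : ∀ x y → y ≡ x ⊕ x × apex x y ≡ x ⊕ κ ⊎ y ≢ x ⊕ x × apex x y ≡ y ─ x
    apex-cases x y with y ≟ (x ⊕ x)
    ... | yes eq = inj₁ (eq , refl)
    ... | no neq = inj₂ (neq , refl)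

  -- The two triangles on an edge thus determine each other. If y = 2x, then x + κ also has double y
  -- because 2κ = 0, and `apex` exchanges x and x + κ. Otherwise y = 2(y - x) would again give y =
  -- 2x, so reflection is applied both times.
  apex-involutive : ∀ x y → apex (apex x y) y ≡ x
  apex-involutive x y with apex-cases x y
  ... | inj₁ (eq , e) = trans (cong (λ z → apex z y) e) (trans
    (apex-double (trans eq (sym (prove-from ((⟨0⟩ :+ ⟨1⟩) :+ (⟨0⟩ :+ ⟨1⟩)) (⟨0⟩ :+ ⟨0⟩) (⟨1⟩ :+ ⟨1⟩) :0 (x ∷ κ ∷ 𝟎 ∷ []) κ⊕κ≡𝟎))))
    (prove-from ((⟨0⟩ :+ ⟨1⟩) :+ ⟨1⟩) ⟨0⟩ (⟨1⟩ :+ ⟨1⟩) :0 (x ∷ κ ∷ 𝟎 ∷ []) κ⊕κ≡𝟎))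
  ... | inj₂ (neq , e) = trans (cong (λ z → apex z y) e) (trans
    (apex-generic λ eq → neq (prove-from ⟨1⟩ (⟨0⟩ :+ ⟨0⟩) ((⟨1⟩ :- ⟨0⟩) :+ (⟨1⟩ :- ⟨0⟩)) ⟨1⟩ (x ∷ y ∷ 𝟎 ∷ []) (sym eq)))
    (prove (⟨1⟩ :- (⟨1⟩ :- ⟨0⟩)) ⟨0⟩ (x ∷ y ∷ 𝟎 ∷ [])))

  ρ : A × A → A × A
  ρ (x , y) = y , apex x y

  -- The dihedral relation: conjugation by `swap` inverts `ρ`.
  ρ-swap-ρ : ∀ p → ρ (swap (ρ p)) ≡ swap p
  ρ-swap-ρ (x , y) = cong (y ,_) (apex-involutive x y)

  -- The orbit of p under the dihedral group generated by ρ and swap.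
  _∼_ : A × A → A × A → Set
  p ∼ q = ∃ λ j → q ≡ fold p ρ j ⊎ q ≡ swap (fold p ρ j)

  ∼-refl : ∀ p → p ∼ p
  ∼-refl p = 0 , inj₁ refl

  ∼-swap : ∀ {p q} → p ∼ q → p ∼ swap q
  ∼-swap (j , inj₁ refl) = j , inj₂ refl
  ∼-swap (j , inj₂ refl) = j , inj₁ refl

  fold-period : ∀ {p} m → fold p ρ m ≡ p → ∀ j → fold (fold p ρ j) ρ m ≡ fold p ρ j
  fold-period {p} m eq j = begin
    fold (fold p ρ j) ρ m ≡⟨ fold-+ p ρ m ⟨
    fold p ρ (m + j)    ≡⟨ cong (fold p ρ) (ℕ.+-comm m j) ⟩
    fold p ρ (j + m)    ≡⟨ fold-+ p ρ j ⟩
    fold (fold p ρ m) ρ j ≡⟨ cong (λ q → fold q ρ j) eq ⟩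
    fold p ρ j            ∎
    where open ≡-Reasoning

  module _ {m : ℕ} {p : A × A} (period : fold p ρ (suc m) ≡ p) where

    ∼-ρ : ∀ {q} → p ∼ q → p ∼ ρ q
    ∼-ρ (j , inj₁ refl)     = suc j , inj₁ refl
    ∼-ρ (suc j , inj₂ refl) = j , inj₂ (ρ-swap-ρ _)
    -- Rotating a reflected pair lowers the exponent by one; at exponent 0 the period first replaces
    -- 0 by `suc m`.
    ∼-ρ (zero , inj₂ refl)  = m , inj₂ (trans (cong (ρ ∘ swap) (sym period)) (ρ-swap-ρ _))

    ∼-trans : ∀ {q r} → p ∼ q → q ∼ r → p ∼ r
    ∼-trans {q} p∼q = λ { (j , inj₁ refl) → go j ; (j , inj₂ refl) → ∼-swap (go j) }
      where
      go : ∀ j → p ∼ fold q ρ j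
      go zero    = p∼q
      go (suc j) = ∼-ρ (go j)

    ∼-unρ : ∀ {q} → p ∼ ρ q → p ∼ q
    ∼-unρ {q} p∼ρq = ∼-swap (subst (p ∼_) (ρ-swap-ρ q) (∼-ρ (∼-swap p∼ρq)))

    -- The same triangle, seen from the vertex u + x.
    ∼-reflect : ∀ {x y} → p ∼ (x , y) → p ∼ (⊖ x , y ─ x)
    ∼-reflect {x} {y} p∼ with y ≟ (x ⊕ x)
    -- Generically the new pair is `swap` of two rotations of the old one. If the second rotation is
    -- antipodal, then y = - x, and one rotation already gives the target; if the first is, one
    -- backward rotation or `swap` alone does.
    ... | no neq = go (apex y (y ─ x)) refl
      where
      p∼ρ : p ∼ (y , y ─ x)
      p∼ρ = subst (λ z → p ∼ (y , z)) (apex-generic neq) (∼-ρ p∼)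
      go : ∀ z → apex y (y ─ x) ≡ z → p ∼ (⊖ x , y ─ x)
      go z eq with (y ─ x) ≟ (y ⊕ y)
      ... | yes e = subst (λ z → p ∼ (z , y ─ x))
                     (prove-from ⟨1⟩ (:- ⟨0⟩) (⟨1⟩ :+ ⟨1⟩) (⟨1⟩ :- ⟨0⟩) (x ∷ y ∷ 𝟎 ∷ []) (sym e)) p∼ρ
      ... | no ne = ∼-swap (subst (λ z → p ∼ (y ─ x , z))
                     (trans (apex-generic ne) (prove ((⟨1⟩ :- ⟨0⟩) :- ⟨1⟩) (:- ⟨0⟩) (x ∷ y ∷ 𝟎 ∷ []))) (∼-ρ p∼ρ))
    ... | yes e with x ≟ (y ⊕ y)
    ...   | no ne = subst₂ (λ w z → p ∼ (w , z))
                     (trans (apex-generic ne) (prove-from (⟨0⟩ :- ⟨1⟩) (:- ⟨0⟩) (⟨0⟩ :+ ⟨0⟩) ⟨1⟩ (x ∷ y ∷ 𝟎 ∷ []) (sym e)))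
                     (prove-from ⟨0⟩ (⟨1⟩ :- ⟨0⟩) (⟨0⟩ :+ ⟨0⟩) ⟨1⟩ (x ∷ y ∷ 𝟎 ∷ []) (sym e))
                     (∼-swap (∼-ρ (∼-swap p∼)))
    ...   | yes e′ = subst₂ (λ w z → p ∼ (w , z))
                     (prove-from ⟨1⟩ (:- ⟨0⟩) (⟨1⟩ :+ ⟨1⟩) (⟨1⟩ :- ⟨0⟩) (x ∷ y ∷ 𝟎 ∷ [])
                       (trans (sym e′) (prove-from ⟨0⟩ (⟨1⟩ :- ⟨0⟩) (⟨0⟩ :+ ⟨0⟩) ⟨1⟩ (x ∷ y ∷ 𝟎 ∷ []) (sym e))))
                     (prove-from ⟨0⟩ (⟨1⟩ :- ⟨0⟩) (⟨0⟩ :+ ⟨0⟩) ⟨1⟩ (x ∷ y ∷ 𝟎 ∷ []) (sym e))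
                     (∼-swap p∼)

  fold-swap-fold : ∀ p j → fold (swap (fold p ρ j)) ρ j ≡ swap p
  fold-swap-fold p zero    = refl
  fold-swap-fold p (suc j) = trans (sym (fold-suc _ ρ j))
    (trans (cong (λ q → fold q ρ j) (ρ-swap-ρ (fold p ρ j))) (fold-swap-fold p j))

  ∼-sym : ∀ {m p q} → fold p ρ (suc m) ≡ p → p ∼ q → q ∼ p
  ∼-sym {m} {p} period (j , inj₁ refl) = unfold j
    where
    unfold : ∀ j → fold p ρ j ∼ p
    unfold zero    = ∼-refl p
    unfold (suc j) = ∼-trans {m} period′ (∼-unρ {m} period′ (∼-refl _)) (unfold j)
      where period′ = fold-period (suc m) period (suc j)
  ∼-sym {p = p} period (j , inj₂ refl) = j , inj₂ (cong swap (sym (fold-swap-fold p j)))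

  -- The condition that 0, x and y are distinct and no two of them antipodal, so that every
  -- translate of {0 , x , y} is a triangle of the cross polytope.
  record Valid (p : A × A) : Set where
    constructor valid
    open Σ p renaming (proj₁ to x; proj₂ to y)
    field
      x≢𝟎   : x ≢ 𝟎
      x≢κ   : x ≢ κ
      y≢𝟎   : y ≢ 𝟎
      y≢κ   : y ≢ κ
      x≢y   : x ≢ y
      x≢y+κ : x ≢ y ⊕ κ

  3× 6× : A → A
  3× x = (x ⊕ x) ⊕ x
  6× x = 3× x ⊕ 3× x

  :3 :6 : ∀ {m} → Term m → Term m
  :3 t = (t :+ t) :+ t
  :6 t = :3 t :+ :3 t

  Octahedral : A × A → Set
  Octahedral (x , y) = 6× x ≡ 𝟎 × 6× y ≡ 𝟎

  ⊕κ-flip : ∀ {x y} → x ⊕ κ ≡ y → x ≡ y ⊕ κ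
  ⊕κ-flip {x} {y} eq = prove-from ⟨0⟩ (⟨1⟩ :+ ⟨2⟩) ((⟨0⟩ :+ ⟨2⟩) :+ :0) (⟨1⟩ :+ (⟨2⟩ :+ ⟨2⟩)) (x ∷ y ∷ κ ∷ [])
    (cong₂ _⊕_ eq (sym κ⊕κ≡𝟎))

  valid-swap : ∀ {p} → Valid p → Valid (swap p)
  valid-swap {x , y} (valid a b c d e f) = valid c d a b (e ∘ sym) (f ∘ ⊕κ-flip ∘ sym)

  valid-ρ : ∀ {p} → Valid p → Valid (ρ p)
  valid-ρ {x , y} (valid a b c d e f) with apex x y | apex-cases x y
  ... | _ | inj₁ (_ , refl) = valid c d
    (λ eq → b (trans (⊕κ-flip eq) (prove (:0 :+ ⟨0⟩) ⟨0⟩ (κ ∷ κ ∷ κ ∷ []))))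
    (λ eq → a (trans (⊕κ-flip eq) κ⊕κ≡𝟎))
    (λ eq → f (⊕κ-flip (sym eq)))
    (λ eq → e (trans (⊕κ-flip refl) (sym eq)))
  ... | _ | inj₂ (_ , refl) = valid c d
    (λ eq → e (prove-from ⟨1⟩ ⟨0⟩ :0 (⟨0⟩ :- ⟨1⟩) (y ∷ x ∷ κ ∷ []) (sym eq)))
    (λ eq → f (⊕κ-flip (prove-from (⟨1⟩ :+ ⟨2⟩) ⟨0⟩ ⟨2⟩ (⟨0⟩ :- ⟨1⟩) (y ∷ x ∷ κ ∷ []) (sym eq))))
    (λ eq → a (prove-from ⟨1⟩ :0 ⟨0⟩ (⟨0⟩ :- ⟨1⟩) (y ∷ x ∷ κ ∷ []) eq))
    (λ eq → b (prove-from ⟨1⟩ ⟨2⟩ ⟨0⟩ ((⟨0⟩ :- ⟨1⟩) :+ ⟨2⟩) (y ∷ x ∷ κ ∷ []) eq))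

  octahedral-swap : ∀ {p} → Octahedral p → Octahedral (swap p)
  octahedral-swap (a , b) = b , a

  octahedral-ρ : ∀ {p} → Octahedral p → Octahedral (ρ p)
  octahedral-ρ {x , y} (a , b) with apex x y | apex-cases x y
  ... | _ | inj₁ (_ , refl) = b , trans
    (prove (:6 (⟨0⟩ :+ ⟨1⟩)) (:6 ⟨0⟩ :+ :3 (⟨1⟩ :+ ⟨1⟩)) (x ∷ κ ∷ κ ∷ []))
    (trans (cong₂ (λ a b → a ⊕ 3× b) a κ⊕κ≡𝟎) (prove (:0 :+ :3 :0) :0 (x ∷ κ ∷ κ ∷ [])))
  ... | _ | inj₂ (_ , refl) = b , trans
    (prove (:6 (⟨1⟩ :- ⟨0⟩)) (:6 ⟨1⟩ :- :6 ⟨0⟩) (x ∷ y ∷ κ ∷ []))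
    (trans (cong₂ _─_ b a) (prove (:0 :- :0) :0 (x ∷ κ ∷ κ ∷ [])))

  -- Outside the three special shapes (x , 2x), (2y , y) and (x , - x), the
  -- rotation is that of the hexagonal lattice.
  record Lattice (p : A × A) : Set where
    constructor lattice
    open Σ p renaming (proj₁ to x; proj₂ to y)
    field
      y≢2x : y ≢ x ⊕ x
      x≢2y : x ≢ y ⊕ y
      y≢-x : y ≢ ⊖ x

  ρ-lattice : ∀ {x y} → Lattice (x , y) → ρ (x , y) ≡ (y , y ─ x)
  ρ-lattice l = cong (_ ,_) (apex-generic (Lattice.y≢2x l))

  -- The linear map permutes the three excluded shapes cyclically: (x , 2x) to (2y , y) to (x , - x)
  -- and back. Avoiding them is therefore a property of the whole orbit.
  lattice-ρ : ∀ {x y} → Lattice (x , y) → Lattice (y , y ─ x)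
  lattice-ρ {x} {y} (lattice a b c) = lattice
    (λ eq → c (prove-from ⟨1⟩ (:- ⟨0⟩) (⟨1⟩ :+ ⟨1⟩) (⟨1⟩ :- ⟨0⟩) (x ∷ y ∷ κ ∷ []) (sym eq)))
    (λ eq → a (prove-from ⟨1⟩ (⟨0⟩ :+ ⟨0⟩) ((⟨1⟩ :- ⟨0⟩) :+ (⟨1⟩ :- ⟨0⟩)) ⟨1⟩ (x ∷ y ∷ κ ∷ []) (sym eq)))
    (λ eq → b (prove-from ⟨0⟩ (⟨1⟩ :+ ⟨1⟩) (:- ⟨1⟩) (⟨1⟩ :- ⟨0⟩) (x ∷ y ∷ κ ∷ []) (sym eq)))

  λρ : A × A → A × A
  λρ (x , y) = y , y ─ x

  fold-lattice : ∀ j {p} → Lattice p → fold p ρ j ≡ fold p λρ j × Lattice (fold p λρ j)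
  fold-lattice zero    l = refl , l
  fold-lattice (suc j) l with eq , l′ ← fold-lattice j l = trans (cong ρ eq) (ρ-lattice l′) , lattice-ρ l′

  -- The linear map T (x , y) = (y , y - x) satisfies T² - T + 1 = 0, hence T³ = -1: it acts as a
  -- primitive sixth root of unity.
  period-lattice : ∀ {p} → Lattice p → fold p ρ 6 ≡ p
  period-lattice {x , y} l = trans (proj₁ (fold-lattice 6 l)) (cong₂ _,_
    (prove (proj₁ (fold (⟨0⟩ , ⟨1⟩) step 6)) ⟨0⟩ (x ∷ y ∷ κ ∷ []))
    (prove (proj₂ (fold (⟨0⟩ , ⟨1⟩) step 6)) ⟨1⟩ (x ∷ y ∷ κ ∷ [])))
    where
    step : Term 3 × Term 3 → Term 3 × Term 3
    step (s , t) = t , t :- s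

  -- The intermediate pairs are (2x , x + κ) and (x + κ , - (x + κ)). The first step is antipodal;
  -- the next two would be so exactly when 3x = κ.
  ρ³-double : ∀ {x} → 3× x ≢ κ → fold (x , x ⊕ x) ρ 3 ≡ (⊖ (x ⊕ κ) , (⊖ (x ⊕ κ)) ⊕ (⊖ (x ⊕ κ)))
  ρ³-double {x} 3x≢κ = begin
    ρ (ρ (ρ (x , x ⊕ x)))             ≡⟨ cong (λ z → ρ (ρ (x ⊕ x , z))) (apex-double refl) ⟩
    ρ (ρ (x ⊕ x , x ⊕ κ))             ≡⟨ cong (λ z → ρ (x ⊕ κ , z)) (apex-generic λ eq → 3x≢κ
                                            (prove-from (:3 ⟨0⟩) ⟨1⟩ ((⟨0⟩ :+ ⟨0⟩) :+ (⟨0⟩ :+ ⟨0⟩)) (⟨0⟩ :+ ⟨1⟩) vs (sym eq))) ⟩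
    ρ (x ⊕ κ , (x ⊕ κ) ─ (x ⊕ x))     ≡⟨ cong₂ _,_
                                           (prove-from ((⟨0⟩ :+ ⟨1⟩) :- (⟨0⟩ :+ ⟨0⟩)) (:- (⟨0⟩ :+ ⟨1⟩)) (⟨1⟩ :+ ⟨1⟩) :0 vs κ⊕κ≡𝟎)
                                           (trans (apex-generic λ eq → 3x≢κ
                                             (prove-from (:3 ⟨0⟩) ⟨1⟩
                                                (((⟨0⟩ :+ ⟨1⟩) :+ (⟨0⟩ :+ ⟨1⟩)) :+ :0)
                                                (((⟨0⟩ :+ ⟨1⟩) :- (⟨0⟩ :+ ⟨0⟩)) :+ (⟨1⟩ :+ ⟨1⟩)) vs
                                                (cong₂ _⊕_ (sym eq) (sym κ⊕κ≡𝟎))))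
                                             (prove-from (((⟨0⟩ :+ ⟨1⟩) :- (⟨0⟩ :+ ⟨0⟩)) :- (⟨0⟩ :+ ⟨1⟩))
                                                ((:- (⟨0⟩ :+ ⟨1⟩)) :+ (:- (⟨0⟩ :+ ⟨1⟩))) (⟨1⟩ :+ ⟨1⟩) :0 vs κ⊕κ≡𝟎)) ⟩
    (⊖ (x ⊕ κ) , (⊖ (x ⊕ κ)) ⊕ (⊖ (x ⊕ κ)))  ∎
    where
    open ≡-Reasoning
    vs = x ∷ κ ∷ κ ∷ []

  4κ≡𝟎 : (κ ⊕ κ) ⊕ (κ ⊕ κ) ≡ 𝟎
  4κ≡𝟎 = trans (cong₂ _⊕_ κ⊕κ≡𝟎 κ⊕κ≡𝟎) (prove (:0 :+ :0) :0 (κ ∷ κ ∷ κ ∷ []))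

  :4κ : ∀ {m} → Term (3 + m)
  :4κ = (⟨1⟩ :+ ⟨1⟩) :+ (⟨1⟩ :+ ⟨1⟩)

  -- The map `w` is an involution, so applying the three-step rule twice returns to the start. The
  -- second application needs 3 (w x) ≠ κ, which amounts to 3x ≠ 0.
  period-double : ∀ {x} → 3× x ≢ 𝟎 → 3× x ≢ κ → fold (x , x ⊕ x) ρ 6 ≡ (x , x ⊕ x)
  period-double {x} 3x≢𝟎 3x≢κ = begin
    fold (x , x ⊕ x) ρ 6                ≡⟨ fold-+ (x , x ⊕ x) ρ 3 {3} ⟩
    fold (fold (x , x ⊕ x) ρ 3) ρ 3     ≡⟨ cong (λ p → fold p ρ 3) (ρ³-double 3x≢κ) ⟩
    fold (w x , w x ⊕ w x) ρ 3          ≡⟨ ρ³-double (λ eq → 3x≢𝟎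
                                              (prove-from (:3 ⟨0⟩) :0 (⟨1⟩ :+ :0) (:3 (:- (⟨0⟩ :+ ⟨1⟩)) :+ :4κ) vs
                                                (cong₂ _⊕_ (sym eq) (sym 4κ≡𝟎)))) ⟩
    (w (w x) , w (w x) ⊕ w (w x))       ≡⟨ cong (λ z → z , z ⊕ z) (prove (:- (:- (⟨0⟩ :+ ⟨1⟩) :+ ⟨1⟩)) ⟨0⟩ vs) ⟩
    (x , x ⊕ x) ∎
    where
    open ≡-Reasoning
    w : A → A
    w x = ⊖ (x ⊕ κ)
    vs = x ∷ κ ∷ κ ∷ []

  ρ-period : ∀ {p} m → fold p ρ m ≡ p → fold (ρ p) ρ m ≡ ρ p
  ρ-period m eq = trans (fold-suc _ ρ m) (cong ρ eq)

  -- The pair (2x , x) is one rotation after the double pair of x + κ, whose antipodal step leads to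
  -- x + 2κ = x.
  period-half : ∀ {x} → 3× x ≢ 𝟎 → 3× x ≢ κ → fold (x ⊕ x , x) ρ 6 ≡ (x ⊕ x , x)
  period-half {x} 3x≢𝟎 3x≢κ = subst (λ p → fold p ρ 6 ≡ p) eq
    (ρ-period {x ⊕ κ , (x ⊕ κ) ⊕ (x ⊕ κ)} 6 (period-double
      (λ e → 3x≢κ (prove-from (:3 ⟨0⟩) ⟨1⟩ (:3 (⟨0⟩ :+ ⟨1⟩) :+ :0) (:0 :+ :4κ) vs (cong₂ _⊕_ e (sym 4κ≡𝟎))))
      (λ e → 3x≢𝟎 (prove-from (:3 ⟨0⟩) :0 (:3 (⟨0⟩ :+ ⟨1⟩) :+ :0) (⟨1⟩ :+ (⟨1⟩ :+ ⟨1⟩)) vs (cong₂ _⊕_ e (sym κ⊕κ≡𝟎))))))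
    where
    vs = x ∷ κ ∷ κ ∷ []
    eq : ρ (x ⊕ κ , (x ⊕ κ) ⊕ (x ⊕ κ)) ≡ (x ⊕ x , x)
    eq = cong₂ _,_ (prove-from ((⟨0⟩ :+ ⟨1⟩) :+ (⟨0⟩ :+ ⟨1⟩)) (⟨0⟩ :+ ⟨0⟩) (⟨1⟩ :+ ⟨1⟩) :0 vs κ⊕κ≡𝟎)
      (trans (apex-double refl) (sym (⊕κ-flip refl)))

  6×≡𝟎 : ∀ {x} → 3× x ≡ 𝟎 ⊎ 3× x ≡ κ → 6× x ≡ 𝟎
  6×≡𝟎 {x} (inj₁ eq) = trans (cong₂ _⊕_ eq eq) (prove (:0 :+ :0) :0 (x ∷ κ ∷ κ ∷ []))
  6×≡𝟎 (inj₂ eq) = trans (cong₂ _⊕_ eq eq) κ⊕κ≡𝟎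

  6×-double : ∀ {x} → 6× x ≡ 𝟎 → 6× (x ⊕ x) ≡ 𝟎
  6×-double {x} eq = trans (prove (:6 (⟨0⟩ :+ ⟨0⟩)) (:6 ⟨0⟩ :+ :6 ⟨0⟩) (x ∷ κ ∷ κ ∷ []))
    (trans (cong₂ _⊕_ eq eq) (prove (:0 :+ :0) :0 (x ∷ κ ∷ κ ∷ [])))

  6×-neg : ∀ {x} → 6× x ≡ 𝟎 → 6× (⊖ x) ≡ 𝟎
  6×-neg {x} eq = trans (prove (:6 (:- ⟨0⟩)) (:- (:6 ⟨0⟩)) (x ∷ κ ∷ κ ∷ []))
    (trans (cong ⊖_ eq) (prove (:- :0) :0 (x ∷ κ ∷ κ ∷ [])))

  -- In each special shape one coordinate is a multiple of the other, so a pair that is not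
  -- octahedral has 3x, or 3y, outside {0 , κ}, as the orbits of double pairs require. All other
  -- pairs are of lattice type.
  period-6 : ∀ {p} → ¬ Octahedral p → fold p ρ 6 ≡ p
  period-6 {x , y} ¬oct with y ≟ (x ⊕ x) | x ≟ (y ⊕ y) | y ≟ (⊖ x)
  ... | yes refl | _        | _        =
    period-double (λ e → oct (inj₁ e)) (λ e → oct (inj₂ e))
    where
    oct : ¬ (3× x ≡ 𝟎 ⊎ 3× x ≡ κ)
    oct e = let e′ = 6×≡𝟎 e in ¬oct (e′ , 6×-double e′)
  ... | no _     | yes refl | _        = period-half (λ e → oct (inj₁ e)) (λ e → oct (inj₂ e))
    where
    oct : ¬ (3× y ≡ 𝟎 ⊎ 3× y ≡ κ)
    oct e = let e′ = 6×≡𝟎 e in ¬oct (6×-double e′ , e′)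
  -- The pair (x , - x) is one rotation after (2x , x).
  ... | no _     | no _     | yes refl = subst (λ p → fold p ρ 6 ≡ p) eq
      (ρ-period {x ⊕ x , x} 6 (period-half (λ e → oct (inj₁ e)) (λ e → oct (inj₂ e))))
    where
    oct : ¬ (3× x ≡ 𝟎 ⊎ 3× x ≡ κ)
    oct e = let e′ = 6×≡𝟎 e in ¬oct (e′ , 6×-neg e′)
    eq : ρ (x ⊕ x , x) ≡ (x , ⊖ x)
    eq = cong (x ,_) (trans
      (apex-generic λ e → oct (inj₁ (prove-from (:3 ⟨0⟩) :0 ((⟨0⟩ :+ ⟨0⟩) :+ (⟨0⟩ :+ ⟨0⟩)) ⟨0⟩ (x ∷ κ ∷ κ ∷ []) (sym e))))
      (prove (⟨0⟩ :- (⟨0⟩ :+ ⟨0⟩)) (:- ⟨0⟩) (x ∷ κ ∷ κ ∷ [])))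
  ... | no a     | no b     | no c     = period-lattice (lattice a b c)

  -- The six vertices of a link are distinct

  module Hexagon (κ≢𝟎 : κ ≢ 𝟎) (torsion : ∀ x → x ⊕ x ≡ 𝟎 → x ≡ 𝟎 ⊎ x ≡ κ) where

    Good : A × A → Set
    Good p = Valid p × ¬ Octahedral p

    octahedral-unρ : ∀ {p} → Octahedral (ρ p) → Octahedral p
    octahedral-unρ {p} o = octahedral-swap (subst Octahedral (ρ-swap-ρ p) (octahedral-ρ (octahedral-swap {ρ p} o)))

    good-ρ : ∀ {p} → Good p → Good (ρ p)
    good-ρ (a , b) = valid-ρ a , b ∘ octahedral-unρ

    good-fold : ∀ {p} j → Good p → Good (fold p ρ j)
    good-fold zero    g = g
    good-fold (suc j) g = good-ρ (good-fold j g)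

    -- The neighbours of u in cyclic order are u + `first p j`: consecutive pairs of an orbit
    -- overlap in one coordinate, so first coordinates describe the whole link.
    first : A × A → ℕ → A
    first p j = proj₁ (fold p ρ j)

    first-2 : ∀ {p} → Good p → first p 2 ≢ proj₁ p
    first-2 {x , y} (val , _) eq with apex-cases x y
    ... | inj₁ (_ , e)  = κ≢𝟎 (prove-from ⟨1⟩ :0 (⟨0⟩ :+ ⟨1⟩) ⟨0⟩ (x ∷ κ ∷ κ ∷ []) (trans (sym e) eq))
    ... | inj₂ (ne , e) = ne (prove-from ⟨1⟩ (⟨0⟩ :+ ⟨0⟩) (⟨1⟩ :- ⟨0⟩) ⟨0⟩ (x ∷ y ∷ κ ∷ []) (trans (sym e) eq))

    -- Generically the third entry is - x, which equals x only for x = 0 or x = κ. An antipodal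
    -- first step gives κ - x instead, and equality would mean y = 2x = κ; an antipodal second step
    -- gives y + κ, excluded by validity.
    first-3 : ∀ {p} → Good p → first p 3 ≢ proj₁ p
    first-3 {x , y} (valid a b c d e f , ¬oct) eq with apex-cases x y
    ... | inj₁ (refl , e₁) = d (prove-from (⟨0⟩ :+ ⟨0⟩) ⟨1⟩ ⟨0⟩ ((⟨0⟩ :+ ⟨1⟩) :- (⟨0⟩ :+ ⟨0⟩)) vs
        (trans (sym eq) (trans (cong (apex (x ⊕ x)) e₁) (apex-generic λ e₂ → ¬oct (octahedral
          (6×≡𝟎 (inj₂ (prove-from (:3 ⟨0⟩) ⟨1⟩ ((⟨0⟩ :+ ⟨0⟩) :+ (⟨0⟩ :+ ⟨0⟩)) (⟨0⟩ :+ ⟨1⟩) vs (sym e₂)))))))))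
      where
      vs = x ∷ κ ∷ κ ∷ []
      octahedral : 6× x ≡ 𝟎 → Octahedral (x , x ⊕ x)
      octahedral e = e , 6×-double e
    ... | inj₂ (ne , e₁) with apex-cases y (y ─ x)
    ...   | inj₁ (_ , e₂) = f (trans (sym eq) (trans (cong (apex y) e₁) e₂))
    ...   | inj₂ (_ , e₂) with torsion x (prove-from (⟨0⟩ :+ ⟨0⟩) :0 ⟨0⟩ ((⟨1⟩ :- ⟨0⟩) :- ⟨1⟩) (x ∷ y ∷ κ ∷ [])
                                 (trans (sym eq) (trans (cong (apex y) e₁) e₂)))
    ...     | inj₁ x≡𝟎 = a x≡𝟎
    ...     | inj₂ x≡κ = b x≡κ

    first-≢ : ∀ {p} → Good p → ∀ i → i < 5 → first p (suc i) ≢ proj₁ p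
    first-≢ g 0 _ eq = Valid.x≢y (proj₁ g) (sym eq)
    first-≢ g 1 _ eq = first-2 g eq
    first-≢ g 2 _ eq = first-3 g eq
    -- Since six rotations are the identity, four steps forward are two steps back; likewise five
    -- are one.
    first-≢ {p} g 3 _ eq = first-2 (good-fold 4 g) (trans (cong proj₁ (period-6 (proj₂ g))) (sym eq))
    first-≢ {p} g 4 _ eq = Valid.x≢y (proj₁ (good-fold 5 g)) (trans eq (sym (cong proj₁ (period-6 (proj₂ g)))))
    first-≢ g (suc (suc (suc (suc (suc _))))) (s≤s (s≤s (s≤s (s≤s (s≤s ())))))

    first-<-≢ : ∀ {p i j} → Good p → i < j → j < 6 → first p i ≢ first p j
    first-<-≢ {p} {i} {j} g i<j j<6 eq = first-≢ (good-fold i g) d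
        (ℕ.≤-trans (s≤s (ℕ.m≤n+m d i)) (ℕ.≤-pred (ℕ.≤-trans (s≤s (ℕ.≤-reflexive (trans (sym (ℕ.+-suc i d)) j≡))) j<6)))
        (trans (cong proj₁ (trans (sym (fold-+ p ρ (suc d))) (cong (fold p ρ) (trans (ℕ.+-comm (suc d) i) j≡)))) (sym eq))
      where
      d = j ∸ suc i
      j≡ : i + suc d ≡ j
      j≡ = trans (ℕ.+-suc i d) (ℕ.m+[n∸m]≡n i<j)

    first-injective : ∀ {p} → Good p → ∀ {i j : Fin 6} → first p (toℕ i) ≡ first p (toℕ j) → i ≡ j
    first-injective g {i} {j} eq with Fin.<-cmp i j
    ... | tri< i<j _ _ = contradiction eq (first-<-≢ g i<j (Fin.toℕ<n j))
    ... | tri≈ _ i≡j _ = i≡j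
    ... | tri> _ _ j<i = contradiction (sym eq) (first-<-≢ g j<i (Fin.toℕ<n i))

-- Images of subsets and cyclic successors

∈-image⁻ : ∀ {m n} {f : Fin m → Fin n} {F : Subset m} {y} → y ∈ image f F → ∃ λ x → x ∈ F × f x ≡ y
∈-image⁻ {f = f} {F} {y} y∈ with Fin.any? (λ w → w ∈? F ×-dec f w Fin.≟ y)
                               | trans (sym (lookup∘tabulate _ y)) ([]=⇒lookup y∈)
... | yes found | _ = found

image-⊆ : ∀ {m n} {f : Fin m → Fin n} {F : Subset m} {G : Subset n} → (∀ {x} → x ∈ F → f x ∈ G) → image f F ⊆ G
image-⊆ {f = f} {F} sub y∈ with x , x∈F , refl ← ∈-image⁻ {f = f} {F} y∈ = sub x∈F

⊆-∣∣-antisym : ∀ {n} {F G : Subset n} → F ⊆ G → ∣ F ∣ ≡ ∣ G ∣ → F ≡ G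
⊆-∣∣-antisym {F = F} F⊆G eq = ⊆-antisym F⊆G back
  where
  back : ∀ {x} → x ∈ _ → x ∈ F
  back {x} x∈G with x ∈? F
  ... | yes x∈F = x∈F
  ... | no  x∉F = contradiction eq (ℕ.<⇒≢ (p⊂q⇒∣p∣<∣q∣ (F⊆G , x , x∈G , x∉F)))

toℕ-next-< : ∀ {m} .{{_ : NonZero m}} (j : Fin m) → suc (toℕ j) < m → toℕ (next j) ≡ suc (toℕ j)
toℕ-next-< {m} j lt = trans (Fin.toℕ-fromℕ< (m%n<n (suc (toℕ j)) m)) (m<n⇒m%n≡m lt)

next-≢ : ∀ {m} (j : Fin (2 + m)) → next j ≢ j
next-≢ {m} j eq with suc (toℕ j) ℕ.<? 2 + m
... | yes lt = ℕ.1+n≢n (trans (sym (toℕ-next-< j lt)) (cong toℕ eq))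
... | no ¬lt = contradiction (trans (sym toℕ-next) (cong toℕ eq))
                 λ 0≡ → ℕ.1+n≢0 (ℕ.suc-injective (trans (sym last) (cong suc (sym 0≡))))
  where
  last : suc (toℕ j) ≡ 2 + m
  last = ℕ.≤-antisym (Fin.toℕ<n j) (ℕ.≮⇒≥ ¬lt)
  toℕ-next : toℕ (next j) ≡ 0
  toℕ-next = trans (Fin.toℕ-fromℕ< (m%n<n (suc (toℕ j)) (2 + m)))
    (trans (cong (_% (2 + m)) last) (n%n≡0 (2 + m)))

-- Surfaces built from translates of a cone

-- The complex whose triangles are the translates {u , u + h j , u + h (j + 1)},
-- u ∈ X, of the triangles of a cone over the polygon h 0 , h 1 , … with apex 0.
module TranslationSurface
  {n : ℕ} {_⊕_ : Op₂ (Fin n)} {𝟎 : Fin n} {⊖_ : Op₁ (Fin n)} (isAbelianGroup : IsAbelianGroup _≡_ _⊕_ 𝟎 ⊖_)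
  {X : Pred (Fin n) 0ℓ} (X? : Decidable X) {m : ℕ} (h : Fin (3 + m) → Fin n) where
  open AbelianGroupSolver isAbelianGroup

  infixl 6 _─_
  _─_ : Fin n → Fin n → Fin n
  x ─ y = x ⊕ (⊖ y)

  Edge : Fin n → Fin n → Set
  Edge x y = ∃ λ j → (x ≡ h j × y ≡ h (next j)) ⊎ (y ≡ h j × x ≡ h (next j))

  triangleAt : Fin n → Fin n → Fin n → Subset n
  triangleAt u x y = setOf (u ∷ u ⊕ x ∷ u ⊕ y ∷ [])

  triangle : Fin n → Fin (3 + m) → Subset n
  triangle u j = triangleAt u (h j) (h (next j))

  K : SimplicialComplex n
  K = generatedBy {P = λ G → ∃ λ u → X u × ∃ λ j → G ≡ triangle u j}
    λ G → Fin.any? λ u → X? u ×-dec Fin.any? λ j → ≡-dec Bool._≟_ G (triangle u j)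

  swap⊆ : ∀ {a b c} → setOf (a ∷ b ∷ c ∷ []) ⊆ setOf {n} (a ∷ c ∷ b ∷ [])
  swap⊆ = setOf-mono λ { (here e) → here e ; (there (here e)) → there (there (here e))
                        ; (there (there (here e))) → there (here e) }

  rot⊆ : ∀ {a b c} → setOf (a ∷ b ∷ c ∷ []) ⊆ setOf {n} (b ∷ a ∷ c ∷ [])
  rot⊆ = setOf-mono λ { (here e) → there (here e) ; (there (here e)) → here e
                      ; (there (there (here e))) → there (there (here e)) }

  edge⇒triangle : ∀ {u x y} → Edge x y → ∃ λ j → triangleAt u x y ⊆ triangle u j
  edge⇒triangle (j , inj₁ (refl , refl)) = j , id
  edge⇒triangle (j , inj₂ (refl , refl)) = j , swap⊆

  ⊕-cancelˡ : ∀ u {x y} → u ⊕ x ≡ u ⊕ y → x ≡ y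
  ⊕-cancelˡ u {x} {y} eq = prove-from (v 1F) (v 2F) (v 0F :+ v 1F) (v 0F :+ v 2F) (u ∷ x ∷ y ∷ []) eq

  module Surface
    (h-injective : ∀ {i j} → h i ≡ h j → i ≡ j)
    (h≢𝟎 : ∀ j → h j ≢ 𝟎)
    -- The consistency condition: a triangle of the cone at u, seen from its vertex u + x, again
    -- comes from an edge of the same polygon.
    (edge-reflect : ∀ {x y} → Edge x y → Edge (⊖ x) (y ─ x))
    (X-⊕h : ∀ {u} j → X u → X (u ⊕ h j))
    (X-translate : ∀ {u x y} → X u → X x → X y → X (u ⊕ (y ─ x)))
    where

    u≢u⊕h : ∀ u j → u ≢ u ⊕ h j
    u≢u⊕h u j eq = h≢𝟎 j (prove-from (v 1F) :0 (v 0F :+ v 1F) (v 0F) (u ∷ h j ∷ []) (sym eq))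

    reflect⊆ : ∀ {u x y} → triangleAt u x y ⊆ triangleAt (u ⊕ x) (⊖ x) (y ─ x)
    reflect⊆ {u} {x} {y} = subst₂ (λ a b → triangleAt u x y ⊆ setOf (u ⊕ x ∷ a ∷ b ∷ []))
      (prove (v 0F) ((v 0F :+ v 1F) :+ (:- v 1F)) (u ∷ x ∷ y ∷ []))
      (prove (v 0F :+ v 2F) ((v 0F :+ v 1F) :+ (v 2F :- v 1F)) (u ∷ x ∷ y ∷ []))
      rot⊆

    -- By `edge-reflect` a triangle can be rebased at any of its vertices, so the star of w consists
    -- of the triangles with base w, and its link is the translated polygon.
    star : ∀ {F w} → Face K F → w ∈ F → X w × ∃ λ j → F ⊆ triangle w j
    star {w = w} (_ , (u , Xu , j , refl) , F⊆) w∈F with ∈-setOf⁻ _ (F⊆ w∈F)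
    ... | here refl = Xu , j , F⊆
    ... | there (here refl)
      with j′ , sub ← edge⇒triangle {u ⊕ h j} (edge-reflect (j , inj₁ (refl , refl)))
      = X-⊕h j Xu , j′ , ⊆-trans F⊆ (⊆-trans reflect⊆ sub)
    ... | there (there (here refl))
      with j′ , sub ← edge⇒triangle {u ⊕ h (next j)} (edge-reflect (j , inj₂ (refl , refl)))
      = X-⊕h (next j) Xu , j′ , ⊆-trans F⊆ (⊆-trans swap⊆ (⊆-trans reflect⊆ sub))

    vertex⇒X : ∀ {w} → IsVertex K w → X w
    vertex⇒X {w} face = proj₁ (star face (x∈⁅x⁆ w))

    triangle-face : ∀ {u} → X u → ∀ j → Face K (triangle u j)
    triangle-face Xu j = _ , (_ , Xu , j , refl) , id

    triangle-unique : ∀ u j → Unique (u ∷ u ⊕ h j ∷ u ⊕ h (next j) ∷ [])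
    triangle-unique u j =
      (u≢u⊕h u j ∷ u≢u⊕h u (next j) ∷ []) ∷
      ((λ eq → next-≢ j (sym (h-injective (⊕-cancelˡ u eq)))) ∷ []) ∷ [] ∷ []

    ∣triangle∣ : ∀ u j → ∣ triangle u j ∣ ≡ 3
    ∣triangle∣ u j = ∣setOf∣ (triangle-unique u j)

    ∣face∣≤3 : ∀ {F} → Face K F → ∣ F ∣ ≤ 3
    ∣face∣≤3 (_ , (u , _ , j , refl) , F⊆) = ℕ.≤-trans (p⊆q⇒∣p∣≤∣q∣ F⊆) (ℕ.≤-reflexive (∣triangle∣ u j))

    module Link {u : Fin n} (Xu : X u) where
      toL : Fin n → Fin (3 + m)
      toL w with Fin.any? (λ j → w Fin.≟ u ⊕ h j)
      ... | yes (j , _) = j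
      -- An arbitrary value: labels outside the link are not vertices of it.
      ... | no  _       = zero

      fromL : Fin (3 + m) → Fin n
      fromL j = u ⊕ h j

      toL∘fromL : ∀ j → toL (u ⊕ h j) ≡ j
      toL∘fromL j with Fin.any? (λ i → u ⊕ h j Fin.≟ u ⊕ h i)
      ... | yes (i , eq) = sym (h-injective (⊕-cancelˡ u eq))
      ... | no ∄         = contradiction (j , refl) ∄

      link-face : ∀ {F} → Face (link K u) F → ∃ λ j → ∀ {x} → x ∈ F → x ∈ˡ u ⊕ h j ∷ u ⊕ h (next j) ∷ []
      link-face {F} (u∉F , face) with _ , j , sub ← star face (x∈p∪q⁺ (inj₁ (x∈⁅x⁆ u))) = j , in-edge
        where
        in-edge : ∀ {x} → x ∈ F → x ∈ˡ u ⊕ h j ∷ u ⊕ h (next j) ∷ []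
        in-edge x∈F with ∈-setOf⁻ _ (sub (x∈p∪q⁺ (inj₂ x∈F)))
        ... | here refl = contradiction x∈F u∉F
        ... | there p   = p

      link-cycle : link K u ≅ ∂polygon (3 + m)
      link-cycle = record
        { to        = toL
        ; from      = fromL
        ; to-face   = λ F face → let j , sub = link-face face in
            _ , (j , refl) , image-⊆ {f = toL} {F} λ x∈F → to-edge (sub x∈F)
        ; from-face = λ { F (_ , (j , refl) , sub) →
            (λ u∈ → let i , _ , eq = ∈-image⁻ {f = fromL} {F} u∈ in u≢u⊕h u i (sym eq)) ,
            _ , (u , Xu , j , refl) ,
            λ x∈ → Sum.[ (λ { p → ∈-setOf⁺ (here (x∈⁅y⁆⇒x≡y u p)) })
                       , (λ p → image-⊆ {f = fromL} {F} (λ i∈F → from-edge (sub i∈F)) p) ]′ (x∈p∪q⁻ _ _ x∈) }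
        ; from∘to   = λ w vert → let j , sub = link-face vert in from-to (sub (x∈⁅x⁆ w))
        ; to∘from   = λ j _ → toL∘fromL j
        }
        where
        to-edge : ∀ {x j} → x ∈ˡ u ⊕ h j ∷ u ⊕ h (next j) ∷ [] → toL x ∈ ⁅ j ⁆ ∪ ⁅ next j ⁆
        to-edge {j = j} (here refl) rewrite toL∘fromL j = x∈p∪q⁺ (inj₁ (x∈⁅x⁆ j))
        to-edge {j = j} (there (here refl)) rewrite toL∘fromL (next j) = x∈p∪q⁺ (inj₂ (x∈⁅x⁆ (next j)))
        from-edge : ∀ {i j} → i ∈ ⁅ j ⁆ ∪ ⁅ next j ⁆ → u ⊕ h i ∈ triangle u j
        from-edge {j = j} i∈ with x∈p∪q⁻ ⁅ j ⁆ _ i∈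
        ... | inj₁ p rewrite x∈⁅y⁆⇒x≡y j p = ∈-setOf⁺ (there (here refl))
        ... | inj₂ p rewrite x∈⁅y⁆⇒x≡y (next j) p = ∈-setOf⁺ (there (there (here refl)))
        from-to : ∀ {w j} → w ∈ˡ u ⊕ h j ∷ u ⊕ h (next j) ∷ [] → fromL (toL w) ≡ w
        from-to (here refl) = cong fromL (toL∘fromL _)
        from-to (there (here refl)) = cong fromL (toL∘fromL _)

    isClosedSurface : ∃ X → IsClosedSurface K
    isClosedSurface (u , Xu) =
      ((triangle u zero , triangle-face Xu zero , ∣triangle∣ u zero) , λ F → ∣face∣≤3) ,
      λ w vert → m , Link.link-cycle (vertex⇒X vert)

    translate-face : ∀ {x y} → X x → X y → ∀ F → Face K F → Face K (image (_⊕ (y ─ x)) F)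
    translate-face {x} {y} Xx Xy F (_ , (u , Xu , j , refl) , F⊆) =
      triangle (u ⊕ (y ─ x)) j , (_ , X-translate Xu Xx Xy , j , refl) ,
      image-⊆ {f = _⊕ (y ─ x)} {F} λ z∈F → moved (∈-setOf⁻ _ (F⊆ z∈F))
      where
      comm : ∀ z → ((u ⊕ z) ⊕ (y ─ x)) ≡ ((u ⊕ (y ─ x)) ⊕ z)
      comm z = prove ((v 0F :+ v 1F) :+ (v 2F :- v 3F)) ((v 0F :+ (v 2F :- v 3F)) :+ v 1F) (u ∷ z ∷ y ∷ x ∷ [])
      moved : ∀ {z} → z ∈ˡ u ∷ u ⊕ h j ∷ u ⊕ h (next j) ∷ [] → (z ⊕ (y ─ x)) ∈ triangle (u ⊕ (y ─ x)) j
      moved (here refl) = ∈-setOf⁺ (here refl)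
      moved (there (here refl)) = ∈-setOf⁺ (there (here (comm _)))
      moved (there (there (here refl))) = ∈-setOf⁺ (there (there (here (comm _))))

    vertexTransitive : VertexTransitive K
    vertexTransitive x y vx vy = record
      { to        = _⊕ (y ─ x)
      ; from      = _⊕ (x ─ y)
      ; to-face   = translate-face (vertex⇒X vx) (vertex⇒X vy)
      ; from-face = translate-face (vertex⇒X vy) (vertex⇒X vx)
      ; from∘to   = λ w _ → prove ((v 0F :+ (v 2F :- v 1F)) :+ (v 1F :- v 2F)) (v 0F) (w ∷ x ∷ y ∷ [])
      ; to∘from   = λ w _ → prove ((v 0F :+ (v 1F :- v 2F)) :+ (v 2F :- v 1F)) (v 0F) (w ∷ x ∷ y ∷ [])
      } , prove (v 0F :+ (v 1F :- v 0F)) (v 1F) (x ∷ y ∷ [])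

    module Count {vs : List (Fin n)} (vs-unique : Unique vs)
                 (X⇒∈ : ∀ {u} → X u → u ∈ˡ vs) (∈⇒X : ∀ {u} → u ∈ˡ vs → X u) where

      #vertices≡ : #vertices K ≡ length vs
      #vertices≡ = trans (sym (ℕ.*-identityʳ _)) (trans
        (#faces-regular K 0 vs (λ u → setOf (u ∷ []) ∷ []) vs-unique (λ _ → [] ∷ []) to from (λ _ → refl))
        (ℕ.*-identityʳ _))
        where
        to : ∀ {u F} → Face K F → ∣ F ∣ ≡ 1 → u ∈ F → u ∈ˡ vs × F ∈ˡ setOf (u ∷ []) ∷ []
        to face eq u∈F = X⇒∈ (proj₁ (star face u∈F)) ,
          here (sym (⊆-∣∣-antisym (λ z∈ → single (∈-setOf⁻ _ z∈)) (trans (∣setOf∣ ([] ∷ [])) (sym eq))))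
          where
          single : ∀ {z} → z ∈ˡ _ ∷ [] → z ∈ _
          single (here refl) = u∈F
        from : ∀ {u F} → u ∈ˡ vs → F ∈ˡ setOf (u ∷ []) ∷ [] → (Face K F × ∣ F ∣ ≡ 1) × u ∈ F
        from u∈ (here refl) =
          (down-closed K (setOf-mono λ { (here e) → here e }) (triangle-face (∈⇒X u∈) zero) , ∣setOf∣ ([] ∷ [])) ,
          ∈-setOf⁺ (here refl)

      #edges≡ : #faces 1 K * 2 ≡ length vs * (3 + m)
      #edges≡ = #faces-regular K 1 vs (λ u → tabulate (edge u)) vs-unique
        (λ {u} _ → Unique.tabulate⁺ (edge-injective u)) to from (λ {u} _ → length-tabulate (edge u))
        where
        edge : Fin n → Fin (3 + m) → Subset n
        edge u j = setOf (u ∷ u ⊕ h j ∷ [])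
        ∣edge∣ : ∀ u j → ∣ edge u j ∣ ≡ 2
        ∣edge∣ u j = ∣setOf∣ ((u≢u⊕h u j ∷ []) ∷ [] ∷ [])
        edge-injective : ∀ u {i j} → edge u i ≡ edge u j → i ≡ j
        edge-injective u {i} {j} eq with ∈-setOf⁻ _ (subst (u ⊕ h i ∈_) eq (∈-setOf⁺ (there (here refl))))
        ... | here p         = contradiction (sym p) (u≢u⊕h u i)
        ... | there (here p) = h-injective (⊕-cancelˡ u p)
        to : ∀ {u F} → Face K F → ∣ F ∣ ≡ 2 → u ∈ F → u ∈ˡ vs × F ∈ˡ tabulate (edge u)
        to {u} {F} face eq u∈F with Xu , j , sub ← star face u∈F
          with u ⊕ h j ∈? F | u ⊕ h (next j) ∈? F
        ... | yes p | _     = X⇒∈ Xu , subst (_∈ˡ _)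
          (⊆-∣∣-antisym (λ z∈ → both (∈-setOf⁻ _ z∈)) (trans (∣edge∣ u j) (sym eq))) (∈-tabulate⁺ {f = edge u} j)
          where
          both : ∀ {z} → z ∈ˡ u ∷ u ⊕ h j ∷ [] → z ∈ F
          both (here refl) = u∈F
          both (there (here refl)) = p
        ... | no _  | yes q = X⇒∈ Xu , subst (_∈ˡ _)
          (⊆-∣∣-antisym (λ z∈ → both (∈-setOf⁻ _ z∈)) (trans (∣edge∣ u (next j)) (sym eq))) (∈-tabulate⁺ {f = edge u} (next j))
          where
          both : ∀ {z} → z ∈ˡ u ∷ u ⊕ h (next j) ∷ [] → z ∈ F
          both (here refl) = u∈F
          both (there (here refl)) = q
        -- Neither link vertex of the triangle lies in F, so F is contained in {u}, against its two
        -- elements.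
        ... | no ¬p | no ¬q = contradiction
          (subst₂ _≤_ eq (∣setOf∣ ([] ∷ [])) (p⊆q⇒∣p∣≤∣q∣ single)) λ { (s≤s ()) }
          where
          single : F ⊆ setOf (u ∷ [])
          single z∈ with ∈-setOf⁻ _ (sub z∈)
          ... | here e                    = ∈-setOf⁺ (here e)
          ... | there (here refl)         = contradiction z∈ ¬p
          ... | there (there (here refl)) = contradiction z∈ ¬q
        from : ∀ {u F} → u ∈ˡ vs → F ∈ˡ tabulate (edge u) → (Face K F × ∣ F ∣ ≡ 2) × u ∈ F
        from {u} u∈ F∈ with j , refl ← ∈-tabulate⁻ {f = edge u} F∈ =
          (down-closed K (setOf-mono λ { (here e) → here e ; (there (here e)) → there (here e) })
            (triangle-face (∈⇒X u∈) j) , ∣edge∣ u j) , ∈-setOf⁺ (here refl)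

      -- Distinct polygon edges must give distinct triangles; two edges with the same endpoints
      -- would be traversed in opposite directions, which `next²` excludes.
      #triangles≡ : (∀ j → next (next j) ≢ j) → #faces 2 K * 3 ≡ length vs * (3 + m)
      #triangles≡ next² = #faces-regular K 2 vs (λ u → tabulate (triangle u)) vs-unique
        (λ {u} _ → Unique.tabulate⁺ (triangle-injective u)) to from (λ {u} _ → length-tabulate (triangle u))
        where
        in-triangle : ∀ {u i j} → u ⊕ h i ∈ triangle u j → i ≡ j ⊎ i ≡ next j
        in-triangle {u} {i} p with ∈-setOf⁻ _ p
        ... | here e                 = contradiction (sym e) (u≢u⊕h u i)
        ... | there (here e)         = inj₁ (h-injective (⊕-cancelˡ u e))
        ... | there (there (here e)) = inj₂ (h-injective (⊕-cancelˡ u e))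
        triangle-injective : ∀ u {i j} → triangle u i ≡ triangle u j → i ≡ j
        triangle-injective u {i} {j} eq
          with in-triangle {u} (subst (u ⊕ h i ∈_) eq (∈-setOf⁺ (there (here refl))))
             | in-triangle {u} (subst (u ⊕ h (next i) ∈_) eq (∈-setOf⁺ (there (there (here refl)))))
        ... | inj₁ e    | _         = e
        ... | inj₂ refl | inj₁ e    = contradiction e (next² j)
        ... | inj₂ refl | inj₂ e    = contradiction e (next-≢ (next j))
        to : ∀ {u F} → Face K F → ∣ F ∣ ≡ 3 → u ∈ F → u ∈ˡ vs × F ∈ˡ tabulate (triangle u)
        to {u} face eq u∈F with Xu , j , sub ← star face u∈F =
          X⇒∈ Xu , subst (_∈ˡ _) (sym (⊆-∣∣-antisym sub (trans eq (sym (∣triangle∣ u j))))) (∈-tabulate⁺ {f = triangle u} j)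
        from : ∀ {u F} → u ∈ˡ vs → F ∈ˡ tabulate (triangle u) → (Face K F × ∣ F ∣ ≡ 3) × u ∈ F
        from {u} u∈ F∈ with j , refl ← ∈-tabulate⁻ {f = triangle u} F∈ =
          (triangle-face (∈⇒X u∈) j , ∣triangle∣ u j) , ∈-setOf⁺ (here refl)

      #faces-3+ : ∀ d → #faces (3 + d) K ≡ 0
      #faces-3+ d = cong length (filter-none _ {xs = allSubsets n} (All.tabulate λ { {F} _ (face , eq) →
        ℕ.<⇒≱ (ℕ.s≤s (ℕ.s≤s (ℕ.s≤s (ℕ.s≤s (z≤n {d}))))) (subst (_≤ 3) eq (∣face∣≤3 face)) }))

-- The Euler characteristic of a surface of degree 6

-- The sum is a - 3a + 2a; the bound 3 ≤ n exposes its first three terms, and `tail` removes the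
-- others.
χ≡0 : ∀ {n a} → 3 ≤ n → (K : SimplicialComplex n) → #faces 0 K ≡ a → #faces 1 K ≡ 3 * a → #faces 2 K ≡ 2 * a →
  (∀ d → #faces (3 + d) K ≡ 0) → χ K ≡ 0ℤ
χ≡0 {suc (suc (suc n))} {a} (s≤s (s≤s (s≤s z≤n))) K f₀ f₁ f₂ f₃₊ = trans
  (cong₂ ℤ._+_ (cong (λ x → -1ℤ ℤ.^ 0 ℤ.* ℤ.+ x) f₀)
    (cong₂ ℤ._+_ (cong (-1ℤ ℤ.^ 1 ℤ.*_) (trans (cong ℤ.+_ f₁) (ℤ.pos-* 3 a)))
      (cong₂ ℤ._+_ (cong (-1ℤ ℤ.^ 2 ℤ.*_) (trans (cong ℤ.+_ f₂) (ℤ.pos-* 2 a))) (tail _ n (λ d → f₃₊ d)))))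
  (solve 1 (λ x → con (ℤ.+ 1) :* x :+ (con -1ℤ :* (con (ℤ.+ 3) :* x) :+ (con (ℤ.+ 1) :* (con (ℤ.+ 2) :* x) :+ con 0ℤ)) := con 0ℤ) refl (ℤ.+ a))
  where
  open ℤ.+-*-Solver
  term : ℕ → ℤ
  term d = -1ℤ ℤ.^ d ℤ.* ℤ.+ #faces d K
  -- A general `g` is needed for the induction: each unfolding of `applyUpTo` composes the function
  -- with `suc`.
  tail : ∀ (g : ℕ → ℕ) m → (∀ d → #faces (g d) K ≡ 0) → List.foldr ℤ._+_ 0ℤ (List.map term (applyUpTo g m)) ≡ 0ℤ
  tail g zero    eq = refl
  tail g (suc m) eq = cong₂ ℤ._+_ (trans (cong (λ x → -1ℤ ℤ.^ g 0 ℤ.* ℤ.+ x) (eq 0)) (ℤ.*-zeroʳ (-1ℤ ℤ.^ g 0)))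
    (tail (g ∘ suc) m (eq ∘ suc))

-- The group of integers modulo n

module IntegersMod (n : ℕ) .{{_ : NonZero n}} where

  ι : ℕ → Fin n
  ι a = a mod n

  abstract
    infixl 6 _⊕_
    infix 8 ⊖_
    _⊕_ : Op₂ (Fin n)
    x ⊕ y = ι (toℕ x + toℕ y)

    ⊖_ : Op₁ (Fin n)
    -- For x = 0 the difference is n itself, which `ι` reduces to 0.
    ⊖ x = ι (n ∸ toℕ x)

  toℕ-ι : ∀ a → toℕ (ι a) ≡ a % n
  toℕ-ι a = Fin.toℕ-fromℕ< (m%n<n a n)

  toℕ-ι-< : ∀ {a} → a < n → toℕ (ι a) ≡ a
  toℕ-ι-< a<n = trans (toℕ-ι _) (m<n⇒m%n≡m a<n)

  ι-toℕ : ∀ x → ι (toℕ x) ≡ x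
  ι-toℕ x = Fin.toℕ-injective (toℕ-ι-< (Fin.toℕ<n x))

  ι-cong : ∀ {a b} → a % n ≡ b % n → ι a ≡ ι b
  ι-cong eq = Fin.toℕ-injective (trans (toℕ-ι _) (trans eq (sym (toℕ-ι _))))

  ι-≡⇒% : ∀ {a b} → ι a ≡ ι b → a % n ≡ b % n
  ι-≡⇒% eq = trans (sym (toℕ-ι _)) (trans (cong toℕ eq) (toℕ-ι _))

  ι≡0⇒∣ : ∀ {a} → ι a ≡ ι 0 → n ∣ a
  ι≡0⇒∣ {a} eq = m%n≡0⇒n∣m a n (trans (ι-≡⇒% eq) (m<n⇒m%n≡m (ℕ.>-nonZero⁻¹ n)))

  ∣⇒ι≡0 : ∀ {a} → n ∣ a → ι a ≡ ι 0
  ∣⇒ι≡0 {a} n∣a = ι-cong (trans (n∣m⇒m%n≡0 a n n∣a) (sym (m<n⇒m%n≡m (ℕ.>-nonZero⁻¹ n))))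

  abstract
    ι-+ : ∀ a b → ι a ⊕ ι b ≡ ι (a + b)
    ι-+ a b = ι-cong (trans (cong₂ (λ x y → (x + y) % n) (toℕ-ι a) (toℕ-ι b)) (sym (%-distribˡ-+ a b n)))

    toℕ-⊕ : ∀ x y → x ⊕ y ≡ ι (toℕ x + toℕ y)
    toℕ-⊕ x y = refl

    ⊖-def : ∀ x → ⊖ x ≡ ι (n ∸ toℕ x)
    ⊖-def x = refl

  isAbelianGroup : IsAbelianGroup _≡_ _⊕_ (ι 0) ⊖_
  isAbelianGroup = record
    { isGroup = record
      { isMonoid = record
        { isSemigroup = record
          { isMagma = record { isEquivalence = isEquivalence ; ∙-cong = cong₂ _⊕_ }
          ; assoc = assoc
          }
        ; identity = identityˡ , λ x → trans (comm x (ι 0)) (identityˡ x)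
        }
      ; inverse = (λ x → trans (comm (⊖ x) x) (inverseʳ x)) , inverseʳ
      ; ⁻¹-cong = cong ⊖_
      }
    ; comm = comm
    }
    where
    open ≡-Reasoning
    comm : ∀ x y → x ⊕ y ≡ y ⊕ x
    comm x y = trans (toℕ-⊕ x y) (trans (cong ι (ℕ.+-comm (toℕ x) (toℕ y))) (sym (toℕ-⊕ y x)))
    assoc : ∀ x y z → (x ⊕ y) ⊕ z ≡ x ⊕ (y ⊕ z)
    assoc x y z = begin
      (x ⊕ y) ⊕ z                             ≡⟨ cong₂ _⊕_ (toℕ-⊕ x y) (sym (ι-toℕ z)) ⟩
      ι (toℕ x + toℕ y) ⊕ ι (toℕ z)          ≡⟨ ι-+ _ _ ⟩
      ι (toℕ x + toℕ y + toℕ z)            ≡⟨ cong ι (ℕ.+-assoc (toℕ x) (toℕ y) (toℕ z)) ⟩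
      ι (toℕ x + (toℕ y + toℕ z))          ≡⟨ ι-+ _ _ ⟨
      ι (toℕ x) ⊕ ι (toℕ y + toℕ z)          ≡⟨ cong₂ _⊕_ (ι-toℕ x) (sym (toℕ-⊕ y z)) ⟩
      x ⊕ (y ⊕ z)                             ∎
    identityˡ : ∀ x → ι 0 ⊕ x ≡ x
    identityˡ x = trans (cong (ι 0 ⊕_) (sym (ι-toℕ x))) (trans (ι-+ 0 (toℕ x)) (ι-toℕ x))
    inverseʳ : ∀ x → x ⊕ (⊖ x) ≡ ι 0
    inverseʳ x = begin
      x ⊕ (⊖ x)                       ≡⟨ cong₂ _⊕_ (sym (ι-toℕ x)) (⊖-def x) ⟩
      ι (toℕ x) ⊕ ι (n ∸ toℕ x)        ≡⟨ ι-+ _ _ ⟩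
      ι (toℕ x + (n ∸ toℕ x))        ≡⟨ cong ι (ℕ.m+[n∸m]≡n (ℕ.<⇒≤ (Fin.toℕ<n x))) ⟩
      ι n                             ≡⟨ ι-cong (trans (n%n≡0 n) (sym (m<n⇒m%n≡m (ℕ.>-nonZero⁻¹ n)))) ⟩
      ι 0                             ∎

-- Faces of the cross polytope as diagonal-free sets

∣++∣ : ∀ {m n} (p : Subset m) (q : Subset n) → ∣ p Vec.++ q ∣ ≡ ∣ p ∣ + ∣ q ∣
∣++∣ []            q = refl
∣++∣ (inside ∷ p)  q = cong suc (∣++∣ p q)
∣++∣ (outside ∷ p) q = ∣++∣ p q

module _ {m n : ℕ} {p : Subset m} {q : Subset n} where

  ↑ˡ-∈-++⁺ : ∀ {i} → i ∈ p → (i ↑ˡ n) ∈ (p Vec.++ q)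
  ↑ˡ-∈-++⁺ {i} i∈ = lookup⇒[]= _ _ (trans (lookup-++ˡ p q i) ([]=⇒lookup i∈))

  ↑ˡ-∈-++⁻ : ∀ {i} → (i ↑ˡ n) ∈ (p Vec.++ q) → i ∈ p
  ↑ˡ-∈-++⁻ {i} i∈ = lookup⇒[]= _ _ (trans (sym (lookup-++ˡ p q i)) ([]=⇒lookup i∈))

  ↑ʳ-∈-++⁺ : ∀ {i} → i ∈ q → (m ↑ʳ i) ∈ (p Vec.++ q)
  ↑ʳ-∈-++⁺ {i} i∈ = lookup⇒[]= _ _ (trans (lookup-++ʳ p q i) ([]=⇒lookup i∈))

  ↑ʳ-∈-++⁻ : ∀ {i} → (m ↑ʳ i) ∈ (p Vec.++ q) → i ∈ q
  ↑ʳ-∈-++⁻ {i} i∈ = lookup⇒[]= _ _ (trans (sym (lookup-++ʳ p q i)) ([]=⇒lookup i∈))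

data Half {k} : Fin (k + k) → Set where
  lower : ∀ i → Half (i ↑ˡ k)
  upper : ∀ i → Half (k ↑ʳ i)

half : ∀ {k} (x : Fin (k + k)) → Half x
half {k} x with splitAt k x | Fin.join-splitAt k k x
... | inj₁ i | refl = lower i
... | inj₂ i | refl = upper i

diagonal-⊆ : ∀ {k} {i : Fin k} {F : Subset (k + k)} → (i ↑ˡ k) ∈ F → (k ↑ʳ i) ∈ F → diagonal i ⊆ F
diagonal-⊆ {k} {i} a b z∈ with x∈p∪q⁻ ⁅ i ↑ˡ k ⁆ _ z∈
... | inj₁ p rewrite x∈⁅y⁆⇒x≡y _ p = a
... | inj₂ p rewrite x∈⁅y⁆⇒x≡y _ p = b

-- Replacing the absent pairs of F by their lower elements gives a facet.
diagonal-free⇒face : ∀ {k} {F : Subset (k + k)} → (∀ i → diagonal {k} i ⊈ F) → Face (∂β k) F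
diagonal-free⇒face {k} {F} free with Vec.splitAt k F
... | F₁ , F₂ , refl = ∁ F₂ Vec.++ F₂ , (card , free′) , sub
  where
  card : ∣ ∁ F₂ Vec.++ F₂ ∣ ≡ k
  card = trans (∣++∣ (∁ F₂) F₂) (trans (cong (_+ ∣ F₂ ∣) (∣∁p∣≡n∸∣p∣ F₂)) (ℕ.m∸n+n≡m (∣p∣≤n F₂)))
  free′ : ∀ i → diagonal {k} i ⊈ (∁ F₂ Vec.++ F₂)
  free′ i d = x∈p⇒x∉∁p (↑ʳ-∈-++⁻ {p = ∁ F₂} (d (x∈p∪q⁺ (inj₂ (x∈⁅x⁆ _)))))
                       (↑ˡ-∈-++⁻ {q = F₂} (d (x∈p∪q⁺ (inj₁ (x∈⁅x⁆ _)))))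
  sub : (F₁ Vec.++ F₂) ⊆ (∁ F₂ Vec.++ F₂)
  sub {x} x∈ with half {k} x
  ... | upper i = ↑ʳ-∈-++⁺ {p = ∁ F₂} (↑ʳ-∈-++⁻ {p = F₁} x∈)
  ... | lower i = ↑ˡ-∈-++⁺ {q = F₂} (x∉p⇒x∈∁p λ i∈F₂ → free i (diagonal-⊆ x∈ (↑ʳ-∈-++⁺ {p = F₁} i∈F₂)))

face⇒diagonal-free : ∀ {k} {F : Subset (k + k)} → Face (∂β k) F → ∀ i → diagonal {k} i ⊈ F
face⇒diagonal-free (G , (_ , free) , F⊆G) i d = free i (⊆-trans d F⊆G)

-- Triangles of the cross polytope as valid pairs

module CrossPolytope (k : ℕ) .{{_ : NonZero (k + k)}} (3≤k : 3 ≤ k) where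

  private
    n = k + k

  open IntegersMod n

  private
    instance
      k≢0 : NonZero k
      k≢0 = ℕ.>-nonZero (ℕ.≤-trans (s≤s z≤n) 3≤k)

  𝟎 κ : Fin n
  𝟎 = ι 0
  κ = ι k

  κ⊕κ≡𝟎 : κ ⊕ κ ≡ 𝟎
  κ⊕κ≡𝟎 = trans (ι-+ k k) (∣⇒ι≡0 ∣-refl)

  κ≢𝟎 : κ ≢ 𝟎
  κ≢𝟎 eq = ℕ.<⇒≱ (ℕ.m<m+n k (ℕ.>-nonZero⁻¹ k)) (∣⇒≤ (ι≡0⇒∣ eq))

  multiple-of-k : ∀ {x q} → toℕ x ≡ q * k → x ≡ 𝟎 ⊎ x ≡ κ
  multiple-of-k {x} {0} e = inj₁ (trans (sym (ι-toℕ x)) (cong ι e))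
  multiple-of-k {x} {1} e = inj₂ (trans (sym (ι-toℕ x)) (cong ι (trans e (ℕ.*-identityˡ k))))
  multiple-of-k {x} {suc (suc r)} e = contradiction (Fin.toℕ<n x)
    (ℕ.≤⇒≯ (subst (n ≤_) (sym (trans e (sym (ℕ.+-assoc k k (r * k))))) (ℕ.m≤m+n n (r * k))))

  torsion : ∀ x → x ⊕ x ≡ 𝟎 → x ≡ 𝟎 ⊎ x ≡ κ
  torsion x eq with divides q e ← ι≡0⇒∣ (trans (sym (toℕ-⊕ x x)) eq) = multiple-of-k {x} {q}
    (ℕ.*-cancelˡ-≡ (toℕ x) (q * k) 2 (trans (cong (toℕ x +_) (ℕ.+-identityʳ (toℕ x)))
      (trans e (trans (ℕ.*-distribˡ-+ q k k) (cong (q * k +_) (sym (ℕ.+-identityʳ (q * k))))))))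

  open AbelianGroupSolver isAbelianGroup
  open Rotation isAbelianGroup Fin._≟_ κ κ⊕κ≡𝟎
  open Hexagon κ≢𝟎 torsion

  lower-⊕κ : ∀ i → (i ↑ˡ k) ⊕ κ ≡ k ↑ʳ i
  lower-⊕κ i = trans (cong (_⊕ κ) (sym (ι-toℕ (i ↑ˡ k)))) (trans (ι-+ _ k) (trans
    (cong ι (trans (cong (_+ k) (Fin.toℕ-↑ˡ i k)) (trans (ℕ.+-comm (toℕ i) k) (sym (Fin.toℕ-↑ʳ k i))))) (ι-toℕ (k ↑ʳ i))))

  upper-⊕κ : ∀ i → (k ↑ʳ i) ⊕ κ ≡ i ↑ˡ k
  upper-⊕κ i = sym (⊕κ-flip (lower-⊕κ i))

  6×≡𝟎⇒∣ : ∀ {x} → 6× x ≡ 𝟎 → n ∣ (toℕ x + toℕ x + toℕ x) + (toℕ x + toℕ x + toℕ x)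
  6×≡𝟎⇒∣ {x} eq = ι≡0⇒∣ (trans (sym (trans (cong₂ _⊕_ 3×-ι 3×-ι) (ι-+ _ _))) eq)
    where
    t = toℕ x
    3×-ι : 3× x ≡ ι (t + t + t)
    3×-ι = trans (cong₂ _⊕_ (toℕ-⊕ x x) (sym (ι-toℕ x))) (ι-+ (t + t) t)

  -- Absence of diagonals in group terms: the antipode is translation by κ, so the condition is
  -- invariant under all translations.
  AntipodeFree : Subset n → Set
  AntipodeFree F = ∀ {x} → x ∈ F → (x ⊕ κ) ∉ F

  antipode-free⇒face : ∀ {F} → AntipodeFree F → Face (∂β k) F
  antipode-free⇒face {F} free = diagonal-free⇒face λ i d →
    free (d (x∈p∪q⁺ (inj₁ (x∈⁅x⁆ _)))) (subst (_∈ F) (sym (lower-⊕κ i)) (d (x∈p∪q⁺ (inj₂ (x∈⁅x⁆ _)))))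

  face⇒antipode-free : ∀ {F} → Face (∂β k) F → AntipodeFree F
  face⇒antipode-free {F} face {x} x∈ x⊕κ∈ with half {k} x
  ... | lower i = face⇒diagonal-free face i (diagonal-⊆ x∈ (subst (_∈ F) (lower-⊕κ i) x⊕κ∈))
  ... | upper i = face⇒diagonal-free face i (diagonal-⊆ (subst (_∈ F) (upper-⊕κ i) x⊕κ∈) x∈)

  valid-fold : ∀ {p} j → Valid p → Valid (fold p ρ j)
  valid-fold zero    val = val
  valid-fold (suc j) val = valid-ρ (valid-fold j val)

  valid-∼ : ∀ {p q} → Valid p → p ∼ q → Valid q
  valid-∼ val (j , inj₁ refl) = valid-fold j val
  valid-∼ val (j , inj₂ refl) = valid-swap (valid-fold j val)

  triangleAt : Fin n → Fin n → Fin n → Subset n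
  triangleAt u x y = setOf (u ∷ u ⊕ x ∷ u ⊕ y ∷ [])

  valid⇒antipode-free : ∀ {u x y} → Valid (x , y) → AntipodeFree (triangleAt u x y)
  valid⇒antipode-free {u} {x} {y} (valid x≢𝟎 x≢κ y≢𝟎 y≢κ x≢y x≢y⊕κ) p q = clash (∈-setOf⁻ _ p) (∈-setOf⁻ _ q)
    where
    shift : ∀ {a b} → (u ⊕ a) ⊕ κ ≡ u ⊕ b → a ⊕ κ ≡ b
    shift {a} {b} eq = prove-from (v 1F :+ v 2F) (v 3F) ((v 0F :+ v 1F) :+ v 2F) (v 0F :+ v 3F) (u ∷ a ∷ κ ∷ b ∷ []) eq
    shift₀ : ∀ {b} → u ⊕ κ ≡ u ⊕ b → κ ≡ b
    shift₀ {b} eq = prove-from (v 1F) (v 2F) (v 0F :+ v 1F) (v 0F :+ v 2F) (u ∷ κ ∷ b ∷ []) eq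
    unshift : ∀ {a} → (u ⊕ a) ⊕ κ ≡ u → κ ≡ a
    unshift {a} eq = sym (trans (⊕κ-flip (prove-from (v 1F :+ v 2F) :0 ((v 0F :+ v 1F) :+ v 2F) (v 0F) (u ∷ a ∷ κ ∷ []) eq))
      (prove (:0 :+ v 0F) (v 0F) (κ ∷ [])))
    κ-moves : ∀ {a} → a ⊕ κ ≢ a
    κ-moves {a} eq = κ≢𝟎 (prove-from (v 1F) :0 (v 0F :+ v 1F) (v 0F) (a ∷ κ ∷ []) eq)
    clash : ∀ {z} → z ∈ˡ u ∷ u ⊕ x ∷ u ⊕ y ∷ [] → ¬ (z ⊕ κ) ∈ˡ u ∷ u ⊕ x ∷ u ⊕ y ∷ []
    clash (here refl) (here e) = κ-moves e
    clash (here refl) (there (here e)) = x≢κ (sym (shift₀ e))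
    clash (here refl) (there (there (here e))) = y≢κ (sym (shift₀ e))
    clash (there (here refl)) (here e) = x≢κ (sym (unshift e))
    clash (there (here refl)) (there (here e)) = κ-moves e
    clash (there (here refl)) (there (there (here e))) = x≢y⊕κ (⊕κ-flip (shift e))
    clash (there (there (here refl))) (here e) = y≢κ (sym (unshift e))
    clash (there (there (here refl))) (there (here e)) = x≢y⊕κ (sym (shift e))
    clash (there (there (here refl))) (there (there (here e))) = κ-moves e

  valid-differences : ∀ {a b c} → a ≢ b → a ≢ c → b ≢ c → b ≢ a ⊕ κ → c ≢ a ⊕ κ → b ≢ c ⊕ κ → Valid (b ─ a , c ─ a)
  valid-differences {a} {b} {c} a≢b a≢c b≢c b≢a⊕κ c≢a⊕κ b≢c⊕κ = valid
    (λ eq → a≢b (prove-from (v 0F) (v 1F) :0 (v 1F :- v 0F) (a ∷ b ∷ []) (sym eq)))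
    (λ eq → b≢a⊕κ (prove-from (v 1F) (v 0F :+ v 2F) (v 1F :- v 0F) (v 2F) (a ∷ b ∷ κ ∷ []) eq))
    (λ eq → a≢c (prove-from (v 0F) (v 1F) :0 (v 1F :- v 0F) (a ∷ c ∷ []) (sym eq)))
    (λ eq → c≢a⊕κ (prove-from (v 1F) (v 0F :+ v 2F) (v 1F :- v 0F) (v 2F) (a ∷ c ∷ κ ∷ []) eq))
    (λ eq → b≢c (prove-from (v 0F) (v 1F) (v 0F :- v 2F) (v 1F :- v 2F) (b ∷ c ∷ a ∷ []) eq))
    (λ eq → b≢c⊕κ (prove-from (v 1F) (v 0F :+ v 2F) (v 1F :- v 3F) ((v 0F :- v 3F) :+ v 2F) (c ∷ b ∷ κ ∷ a ∷ []) eq))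

  triangle-view : ∀ {F} → Face (∂β k) F → ∣ F ∣ ≡ 3 → ∃[ u ] ∃[ x ] ∃[ y ] Valid (x , y) × F ≡ triangleAt u x y
  triangle-view {F} face ∣F∣≡3 with elements F | trans (length-elements F) ∣F∣≡3 | elements-unique F | setOf-elements F
  ... | a ∷ b ∷ c ∷ [] | _ | (a≢b ∷ a≢c ∷ []) ∷ (b≢c ∷ []) ∷ _ | refl =
    a , b ─ a , c ─ a , valid-differences a≢b a≢c b≢c
      (λ eq → free a∈ (subst (_∈ F′) eq b∈)) (λ eq → free a∈ (subst (_∈ F′) eq c∈)) (λ eq → free c∈ (subst (_∈ F′) eq b∈)) ,
    cong₂ (λ s t → setOf (a ∷ s ∷ t ∷ [])) (back b) (back c)
    where
    F′ = setOf (a ∷ b ∷ c ∷ [])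
    free : AntipodeFree F′
    free = face⇒antipode-free face
    a∈ : a ∈ F′
    a∈ = ∈-setOf⁺ (here refl)
    b∈ : b ∈ F′
    b∈ = ∈-setOf⁺ (there (here refl))
    c∈ : c ∈ F′
    c∈ = ∈-setOf⁺ (there (there (here refl)))
    back : ∀ z → z ≡ a ⊕ (z ─ a)
    back z = prove (v 1F) (v 0F :+ (v 1F :- v 0F)) (a ∷ z ∷ [])

  -- The surface of an orbit

  module OrbitSurface {X : Pred (Fin n) 0ℓ} (X? : Decidable X) (m : ℕ) (p : Fin n × Fin n)
    (period : fold p ρ (3 + m) ≡ p) (valid-p : Valid p)
    (injective : ∀ {i j : Fin (3 + m)} → first p (toℕ i) ≡ first p (toℕ j) → i ≡ j)
    (X-⊕h : ∀ {u} (j : Fin (3 + m)) → X u → X (u ⊕ first p (toℕ j)))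
    (X-translate : ∀ {u x y} → X u → X x → X y → X (u ⊕ (y ─ x)))
    where

    open module T = TranslationSurface isAbelianGroup X? {m} (first p ∘ toℕ) using (K; Edge) public

    -- The second coordinate of a pair is the first coordinate of its successor; the period closes
    -- the polygon at the last index.
    edge-pair : ∀ (j : Fin (3 + m)) → (first p (toℕ j) , first p (toℕ (next j))) ≡ fold p ρ (toℕ j)
    edge-pair j = cong (first p (toℕ j) ,_) (cong proj₁ (fold-mod ρ (3 + m) period (suc (toℕ j))))

    edge⇒∼ : ∀ {x y} → Edge x y → p ∼ (x , y)
    edge⇒∼ (j , inj₁ (refl , refl)) = toℕ j , inj₁ (edge-pair j)
    edge⇒∼ (j , inj₂ (refl , refl)) = toℕ j , inj₂ (cong swap (edge-pair j))

    ∼⇒edge : ∀ {x y} → p ∼ (x , y) → Edge x y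
    ∼⇒edge (i , r) = j , Sum.map (λ eq → cong proj₁ (at eq) , cong proj₂ (at eq))
                                 (λ eq → cong proj₁ (at (cong swap eq)) , cong proj₂ (at (cong swap eq))) r
      where
      j = i mod (3 + m)
      at : ∀ {q} → q ≡ fold p ρ i → q ≡ (first p (toℕ j) , first p (toℕ (next j)))
      at eq = trans eq (trans (sym (fold-mod ρ (3 + m) period i)) (sym (edge-pair j)))

    open module S = T.Surface injective (λ j → Valid.x≢𝟎 (valid-fold (toℕ j) valid-p))
      (λ e → ∼⇒edge (∼-reflect {2 + m} period (edge⇒∼ e))) X-⊕h X-translate public
      using (isClosedSurface; vertexTransitive; vertex⇒X; module Count)

    face⇒antipode-free′ : ∀ {F} → Face K F → AntipodeFree F
    face⇒antipode-free′ (_ , (u , _ , j , refl) , F⊆) x∈ x⊕κ∈ =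
      valid⇒antipode-free {u} (subst Valid (sym (edge-pair j)) (valid-fold (toℕ j) valid-p)) (F⊆ x∈) (F⊆ x⊕κ∈)

    ≤-skel : K ≤ᶜ skel₂β k
    ≤-skel F face = antipode-free⇒face (face⇒antipode-free′ face) , S.∣face∣≤3 face

    triangle-face : ∀ {u x y} → X u → p ∼ (x , y) → Face K (triangleAt u x y)
    triangle-face {u} Xu p∼ with j , sub ← T.edge⇒triangle {u} (∼⇒edge p∼) = _ , (_ , Xu , j , refl) , sub

    -- The converse behind uniqueness of the surface. `star` rebases the triangle at u; as x and y
    -- are nonzero and distinct, they are the two ends of one polygon edge, that is, a pair of the
    -- orbit up to order.
    triangle-face⁻ : ∀ {u x y} → Valid (x , y) → Face K (triangleAt u x y) → X u × p ∼ (x , y)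
    triangle-face⁻ {u} {x} {y} val face with Xu , j , sub ← S.star face (∈-setOf⁺ (here refl)) =
      Xu , edge⇒∼ (j , pick (on (Valid.x≢𝟎 val) (sub (∈-setOf⁺ (there (here refl)))))
                            (on (Valid.y≢𝟎 val) (sub (∈-setOf⁺ (there (there (here refl)))))))
      where
      on : ∀ {z} → z ≢ 𝟎 → (u ⊕ z) ∈ T.triangle u j → z ≡ first p (toℕ j) ⊎ z ≡ first p (toℕ (next j))
      on {z} z≢𝟎 z∈ with ∈-setOf⁻ _ z∈
      ... | here e                 = contradiction (prove-from (v 1F) :0 (v 0F :+ v 1F) (v 0F) (u ∷ z ∷ []) e) z≢𝟎
      ... | there (here e)         = inj₁ (T.⊕-cancelˡ u e)
      ... | there (there (here e)) = inj₂ (T.⊕-cancelˡ u e)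
      pick : ∀ {a b} → x ≡ a ⊎ x ≡ b → y ≡ a ⊎ y ≡ b → (x ≡ a × y ≡ b) ⊎ (y ≡ a × x ≡ b)
      pick (inj₁ e) (inj₂ f) = inj₁ (e , f)
      pick (inj₂ e) (inj₁ f) = inj₂ (f , e)
      pick (inj₁ e) (inj₁ f) = contradiction (trans e (sym f)) (Valid.x≢y val)
      pick (inj₂ e) (inj₂ f) = contradiction (trans e (sym f)) (Valid.x≢y val)

  next²-≢ : (j : Fin 6) → next (next j) ≢ j
  next²-≢ = from-yes (Fin.all? {n = 6} λ j → ¬? (next (next j) Fin.≟ j))

  module FlatSurface (p : Fin n × Fin n) (good : Good p) where
    -- Every label is a base point, and the argument 3 makes the polygon a hexagon.
    open OrbitSurface {X = λ _ → ⊤} (λ _ → yes tt) 3 p (period-6 (proj₂ good)) (proj₁ good)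
      (first-injective good) (λ _ _ → tt) (λ _ _ _ → tt) public

    open Count (Unique.allFin⁺ n) (λ _ → ∈-allFin _) (λ _ → tt)

    length-vertices : length (allFin n) ≡ n
    length-vertices = length-tabulate id

    #vertices≡2k : #vertices K ≡ 2 * k
    #vertices≡2k = trans #vertices≡ (trans length-vertices (cong (k +_) (sym (ℕ.+-identityʳ k))))

    χ-K≡0 : χ K ≡ 0ℤ
    χ-K≡0 = χ≡0 {a = length (allFin n)} (ℕ.≤-trans 3≤k (ℕ.m≤m+n k k)) K #vertices≡
      (ℕ.*-cancelʳ-≡ _ _ 2 (trans #edges≡ (regroup 3 2)))
      (ℕ.*-cancelʳ-≡ _ _ 3 (trans (#triangles≡ next²-≢) (regroup 2 3)))
      #faces-3+
      where
      regroup : ∀ a b → length (allFin n) * (a * b) ≡ a * length (allFin n) * b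
      regroup a b = trans (sym (ℕ.*-assoc (length (allFin n)) a b)) (cong (_* b) (ℕ.*-comm _ a))

-- Representatives of the classes of a finite partition

lookup-allPairs : ∀ {A : Set} {R : A → A → Set} {xs : List A} → AllPairs R xs →
  ∀ {i j} → i Fin.< j → R (List.lookup xs i) (List.lookup xs j)
lookup-allPairs {xs = x ∷ xs} (r ∷ _)  {zero}  {suc j} _         = All.lookup r (∈-lookup j)
lookup-allPairs {xs = x ∷ xs} (_ ∷ rs) {suc i} {suc j} (s≤s i<j) = lookup-allPairs rs i<j

length-filter-∉ : ∀ {n} {zs : List (Fin n)} (_∉?zs : ∀ x → Dec (x ∉ˡ zs)) → Unique zs →
  length zs + length (filter _∉?zs (allFin n)) ≡ n
length-filter-∉ {n} {zs} ∉? uzs = trans (sym (length-++ zs)) (trans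
  (unique-length
    (Unique.++⁺ uzs (Unique.filter⁺ ∉? (Unique.allFin⁺ n))
      λ { (p , q) → proj₂ (∈-filter⁻ ∉? {xs = allFin n} q) p })
    (Unique.allFin⁺ n) (λ _ → ∈-allFin _) split)
  (length-tabulate id))
  where
  open DecMembership (Fin._≟_ {n}) using () renaming (_∈?_ to _∈ˡ?_)
  split : ∀ {x} → x ∈ˡ allFin n → x ∈ˡ zs ++ filter ∉? (allFin n)
  split {x} _ with x ∈ˡ? zs
  ... | yes p = ∈-++⁺ˡ p
  ... | no ¬p = ∈-++⁺ʳ zs (∈-filter⁺ ∉? (∈-allFin x) ¬p)

module Representatives {A : Set} (_≟_ : DecidableEquality A) (class : A → List A) where
  open DecMembership _≟_ using () renaming (_∈?_ to _∈ˡ?_)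

  covered? : ∀ x rs → Dec (Any (λ r → x ∈ˡ class r) rs)
  covered? x = Any.any? (λ r → x ∈ˡ? class r)

  reps : List A → List A
  reps []       = []
  reps (x ∷ xs) with covered? x (reps xs)
  ... | yes _ = reps xs
  ... | no  _ = x ∷ reps xs

  reps-⊆ : ∀ xs {r} → r ∈ˡ reps xs → r ∈ˡ xs
  reps-⊆ (x ∷ xs) r∈ with covered? x (reps xs) | r∈
  ... | yes _ | p         = there (reps-⊆ xs p)
  ... | no  _ | here refl = here refl
  ... | no  _ | there p   = there (reps-⊆ xs p)

  reps-cover : ∀ xs → (∀ {x} → x ∈ˡ xs → x ∈ˡ class x) → ∀ {x} → x ∈ˡ xs → Any (λ r → x ∈ˡ class r) (reps xs)
  reps-cover (x ∷ xs) refl-class x∈ with covered? x (reps xs) | x∈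
  ... | yes p | here refl = p
  ... | yes _ | there q   = reps-cover xs (refl-class ∘ there) q
  ... | no  _ | here refl = here (refl-class (here refl))
  ... | no  _ | there q   = there (reps-cover xs (refl-class ∘ there) q)

  reps-apart : ∀ xs → AllPairs (λ x r → x ∉ˡ class r) (reps xs)
  reps-apart []       = []
  reps-apart (x ∷ xs) with covered? x (reps xs)
  ... | yes _ = reps-apart xs
  ... | no ¬p = ¬Any⇒All¬ _ ¬p ∷ reps-apart xs

  module Partition {xs : List A} (xs-unique : Unique xs)
    (class-refl : ∀ {x} → x ∈ˡ xs → x ∈ˡ class x)
    (class-closed : ∀ {x y} → x ∈ˡ xs → y ∈ˡ class x → y ∈ˡ xs)
    (class-sym : ∀ {x y} → x ∈ˡ xs → y ∈ˡ class x → x ∈ˡ class y)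
    (class-trans : ∀ {x y z} → x ∈ˡ xs → y ∈ˡ class x → z ∈ˡ class y → z ∈ˡ class x)
    where

    rep : Fin (length (reps xs)) → A
    rep = List.lookup (reps xs)

    rep∈ : ∀ i → rep i ∈ˡ xs
    rep∈ i = reps-⊆ xs (∈-lookup i)

    -- The greedy choice only keeps an earlier representative out of the class of a later one, so
    -- symmetry and transitivity are applied to place the earlier one there.
    rep-unique : ∀ {x i j} → x ∈ˡ class (rep i) → x ∈ˡ class (rep j) → i ≡ j
    rep-unique {x} {i} {j} p q with Fin.<-cmp i j
    ... | tri≈ _ i≡j _ = i≡j
    ... | tri< i<j _ _ = contradiction (class-trans (rep∈ j) q (class-sym (rep∈ i) p))
                           (lookup-allPairs (reps-apart xs) i<j)
    ... | tri> _ _ j<i = contradiction (class-trans (rep∈ i) p (class-sym (rep∈ j) q))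
                           (lookup-allPairs (reps-apart xs) j<i)

    rep-of : ∀ {x} → x ∈ˡ xs → ∃! _≡_ λ i → x ∈ˡ class (rep i)
    rep-of {x} x∈ = Any.index p , lookup-index p , λ q → rep-unique (lookup-index p) q
      where
      p = reps-cover xs class-refl x∈

    -- Both sides count pairs of a representative and a member of its class; `rep-of` makes the
    -- representative unique for each member.
    length-reps : ∀ {c} → (∀ {x} → x ∈ˡ xs → Unique (class x)) → (∀ {x} → x ∈ˡ xs → length (class x) ≡ c) →
      length (reps xs) * c ≡ length xs
    length-reps {c} class-unique class-length = begin
      length (reps xs) * c ≡⟨ cong (_* c) (length-tabulate {n = length (reps xs)} id) ⟨
      length (allFin (length (reps xs))) * c ≡⟨ double-counting (class ∘ rep) (λ x → filter (λ i → x ∈ˡ? class (rep i)) (allFin _))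
           (Unique.allFin⁺ _) xs-unique (λ _ → class-unique (rep∈ _)) (λ _ → Unique.filter⁺ _ (Unique.allFin⁺ _))
           (λ {i} {x} _ x∈ → class-closed (rep∈ i) x∈ , ∈-filter⁺ (λ i → x ∈ˡ? class (rep i)) (∈-allFin i) x∈)
           (λ {i} {x} _ i∈ → ∈-allFin i , proj₂ (∈-filter⁻ (λ i → x ∈ˡ? class (rep i)) {xs = allFin _} i∈))
           (λ _ → class-length (rep∈ _)) single ⟩
      length xs * 1 ≡⟨ ℕ.*-identityʳ _ ⟩
      length xs ∎
      where
      open ≡-Reasoning
      single : ∀ {x} → x ∈ˡ xs → length (filter (λ i → x ∈ˡ? class (rep i)) (allFin _)) ≡ 1
      single {x} x∈ with i , x∈i , uniq ← rep-of x∈ =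
        unique-length (Unique.filter⁺ _ (Unique.allFin⁺ _)) ([] ∷ [])
          (λ j∈ → here (sym (uniq (proj₂ (∈-filter⁻ (λ i → x ∈ˡ? class (rep i)) {xs = allFin _} j∈)))))
          λ { (here refl) → ∈-filter⁺ (λ i → x ∈ˡ? class (rep i)) (∈-allFin i) x∈i }

-- Hexagonal surfaces: existence, uniqueness and number

module Decomposition (k : ℕ) .{{_ : NonZero (k + k)}} (3≤k : 3 ≤ k) where
  open CrossPolytope k 3≤k
  private
    n = k + k
  open IntegersMod n
  open Rotation isAbelianGroup Fin._≟_ κ κ⊕κ≡𝟎
  open Hexagon κ≢𝟎 torsion
  open DecMembership (Fin._≟_ {n}) using () renaming (_∈?_ to _∈ˡ?_)
  open AbelianGroupSolver isAbelianGroup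

  private
    _≟ₚ_ : DecidableEquality (Fin n × Fin n)
    _≟ₚ_ = Product.≡-dec Fin._≟_ Fin._≟_

  module DihedralClass (ℓ : ℕ) .{{_ : NonZero ℓ}} where

    -- A finite list for the dihedral orbit of p when `ρ` has period ℓ there.
    rotations reflections class : Fin n × Fin n → List (Fin n × Fin n)
    rotations p   = tabulate {n = ℓ} (fold p ρ ∘ toℕ)
    reflections p = tabulate {n = ℓ} (swap ∘ fold p ρ ∘ toℕ)
    class p       = rotations p ++ reflections p

    ∈-rotations⁻ : ∀ {p q} → q ∈ˡ rotations p → ∃ λ (j : Fin ℓ) → q ≡ fold p ρ (toℕ j)
    ∈-rotations⁻ {p} = ∈-tabulate⁻ {f = fold p ρ ∘ toℕ}

    ∈-reflections⁻ : ∀ {p q} → q ∈ˡ reflections p → ∃ λ (j : Fin ℓ) → q ≡ swap (fold p ρ (toℕ j))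
    ∈-reflections⁻ {p} = ∈-tabulate⁻ {f = swap ∘ fold p ρ ∘ toℕ}

    ∈-class⁻ : ∀ {p q} → q ∈ˡ class p → p ∼ q
    ∈-class⁻ {p} q∈ with ∈-++⁻ (rotations p) q∈
    ... | inj₁ a = let j , e = ∈-rotations⁻ {p} a in toℕ j , inj₁ e
    ... | inj₂ b = let j , e = ∈-reflections⁻ {p} b in toℕ j , inj₂ e

    length-class : ∀ p → length (class p) ≡ ℓ + ℓ
    length-class p = begin
      length (class p)                                   ≡⟨ length-++ (rotations p) ⟩
      length (rotations p) + length (reflections p)    ≡⟨ cong (_+ length (reflections p)) (length-tabulate (fold p ρ ∘ toℕ)) ⟩
      ℓ + length (reflections p)                       ≡⟨ cong (ℓ +_) (length-tabulate (swap ∘ fold p ρ ∘ toℕ)) ⟩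
      ℓ + ℓ                                            ∎
      where open ≡-Reasoning

    module _ {p : Fin n × Fin n} (period : fold p ρ ℓ ≡ p) where

      ∈-class⁺ : ∀ {q} → p ∼ q → q ∈ˡ class p
      ∈-class⁺ (j , inj₁ refl) = ∈-++⁺ˡ (subst (_∈ˡ rotations p) (fold-mod ρ ℓ period j)
        (∈-tabulate⁺ {f = fold p ρ ∘ toℕ} (j mod ℓ)))
      ∈-class⁺ (j , inj₂ refl) = ∈-++⁺ʳ (rotations p) (subst (_∈ˡ reflections p) (cong swap (fold-mod ρ ℓ period j))
        (∈-tabulate⁺ {f = swap ∘ fold p ρ ∘ toℕ} (j mod ℓ)))

      -- A rotation i equal to a reflection j would be the polygon edge j traversed backwards; then
      -- `next i` = j and `next j` = i, so two steps along the polygon would return to i.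
      class-unique : (∀ {i j : Fin ℓ} → first p (toℕ i) ≡ first p (toℕ j) → i ≡ j) →
        (∀ (j : Fin ℓ) → next (next j) ≢ j) → Unique (class p)
      class-unique injective next²-≢ = Unique.++⁺
        (Unique.tabulate⁺ λ {i} {j} e → injective {i} {j} (cong proj₁ e))
        (Unique.tabulate⁺ λ {i} {j} e → injective {i} {j} (cong proj₂ e))
        λ (a , b) → disjoint (∈-rotations⁻ {p} a) (∈-reflections⁻ {p} b)
        where
        second : ∀ (j : Fin ℓ) → proj₂ (fold p ρ (toℕ j)) ≡ first p (toℕ (next j))
        second j = sym (cong proj₁ (fold-mod ρ ℓ period (suc (toℕ j))))
        disjoint : ∀ {q} → ∃ (λ (i : Fin ℓ) → q ≡ fold p ρ (toℕ i)) → ¬ ∃ (λ (j : Fin ℓ) → q ≡ swap (fold p ρ (toℕ j)))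
        disjoint (i , refl) (j , e) = next²-≢ i (trans
          (cong next (injective {next i} {j} (trans (sym (second i)) (cong proj₂ e))))
          (sym (injective {i} {next j} (trans (cong proj₁ e) (second j)))))

  private
    module Class₆ = DihedralClass 6
  class : Fin n × Fin n → List (Fin n × Fin n)
  class = Class₆.class

  ∈-class⁺ : ∀ {p q} → Good p → p ∼ q → q ∈ˡ class p
  ∈-class⁺ g = Class₆.∈-class⁺ (period-6 (proj₂ g))

  good-∼ : ∀ {p q} → Good p → p ∼ q → Good q
  good-∼ g (j , inj₁ refl) = good-fold j g
  good-∼ g (j , inj₂ refl) = let a , b = good-fold j g in valid-swap a , b ∘ octahedral-swap

  Valid? : ∀ p → Dec (Valid p)
  Valid? (x , y) = map′ (λ ((a , b) , (c , d) , e , f) → valid a b c d e f)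
                        (λ (valid a b c d e f) → (a , b) , (c , d) , e , f)
    ((¬? (x Fin.≟ 𝟎) ×-dec ¬? (x Fin.≟ κ)) ×-dec (¬? (y Fin.≟ 𝟎) ×-dec ¬? (y Fin.≟ κ)) ×-dec
      (¬? (x Fin.≟ y) ×-dec ¬? (x Fin.≟ y ⊕ κ)))

  Octahedral? : ∀ p → Dec (Octahedral p)
  Octahedral? (x , y) = (6× x Fin.≟ 𝟎) ×-dec (6× y Fin.≟ 𝟎)

  Good? : ∀ p → Dec (Good p)
  Good? p = Valid? p ×-dec ¬? (Octahedral? p)

  private
    pairs : List (Fin n × Fin n)
    pairs = cartesianProduct (allFin n) (allFin n)

    ∈-pairs : ∀ p → p ∈ˡ pairs
    ∈-pairs (x , y) = ∈-cartesianProduct⁺ (∈-allFin x) (∈-allFin y)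

    pairs-unique : Unique pairs
    pairs-unique = Unique.cartesianProduct⁺ (Unique.allFin⁺ n) (Unique.allFin⁺ n)

  abstract
    validPairs goodPairs : List (Fin n × Fin n)
    validPairs = filter Valid? pairs
    goodPairs  = filter Good? pairs

    validPairs-unique : Unique validPairs
    validPairs-unique = Unique.filter⁺ Valid? pairs-unique

    goodPairs-unique : Unique goodPairs
    goodPairs-unique = Unique.filter⁺ Good? pairs-unique

    ∈-valid⁻ : ∀ {p} → p ∈ˡ validPairs → Valid p
    ∈-valid⁻ p∈ = proj₂ (∈-filter⁻ Valid? {xs = pairs} p∈)

    ∈-valid⁺ : ∀ {p} → Valid p → p ∈ˡ validPairs
    ∈-valid⁺ val = ∈-filter⁺ Valid? (∈-pairs _) val

    ∈-good⁻ : ∀ {p} → p ∈ˡ goodPairs → Good p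
    ∈-good⁻ p∈ = proj₂ (∈-filter⁻ Good? {xs = pairs} p∈)

    ∈-good⁺ : ∀ {p} → Good p → p ∈ˡ goodPairs
    ∈-good⁺ g = ∈-filter⁺ Good? (∈-pairs _) g

  abstract
    -- The coordinate x avoids 0 and κ; given x, the coordinate y avoids the four distinct elements
    -- 0, κ, x and x + κ. The factors are described by sums so that no truncated subtraction enters
    -- later.
    length-validPairs : ∃[ a ] ∃[ b ] 2 + a ≡ n × 4 + b ≡ n × a * b ≡ length validPairs
    length-validPairs = length (filter fst? (allFin n)) , n ∸ 4 ,
      length-filter-∉ {zs = 𝟎 ∷ κ ∷ []} fst? fst-unique ,
      ℕ.m+[n∸m]≡n (ℕ.≤-trans (s≤s (s≤s (s≤s (s≤s z≤n)))) (ℕ.+-mono-≤ 3≤k 3≤k)) ,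
      trans (double-counting (λ x → List.map (x ,_) (filter (snd? x) (allFin n))) (λ p → proj₁ p ∷ [])
        (Unique.filter⁺ fst? (Unique.allFin⁺ n)) validPairs-unique
        (λ {x} _ → Unique.map⁺ (cong proj₂) (Unique.filter⁺ (snd? x) (Unique.allFin⁺ n))) (λ _ → [] ∷ [])
        to from
        (λ {x} x∈ → trans (length-map (x ,_) (filter (snd? x) (allFin n))) (ℕ.+-cancelˡ-≡ 4 _ _
          (trans (length-filter-∉ {zs = zs x} (snd? x) (snd-unique x∈)) (sym (ℕ.m+[n∸m]≡n {4}
            (ℕ.≤-trans (s≤s (s≤s (s≤s (s≤s z≤n)))) (ℕ.+-mono-≤ 3≤k 3≤k)))))))
        (λ _ → refl))
      (ℕ.*-identityʳ _)
      where
      zs : Fin n → List (Fin n)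
      zs x = 𝟎 ∷ κ ∷ x ∷ x ⊕ κ ∷ []
      fst? : ∀ x → Dec (x ∉ˡ 𝟎 ∷ κ ∷ [])
      fst? x = ¬? (x ∈ˡ? 𝟎 ∷ κ ∷ [])
      snd? : ∀ x y → Dec (y ∉ˡ zs x)
      snd? x y = ¬? (y ∈ˡ? zs x)
      fst-unique : Unique (𝟎 ∷ κ ∷ [])
      fst-unique = ((κ≢𝟎 ∘ sym) ∷ []) ∷ [] ∷ []
      snd-unique : ∀ {x} → x ∈ˡ filter fst? (allFin n) → Unique (zs x)
      snd-unique {x} x∈ with x∉ ← proj₂ (∈-filter⁻ fst? {xs = allFin n} x∈) =
        ((κ≢𝟎 ∘ sym) ∷ (λ e → x∉ (here (sym e))) ∷
          (λ e → x∉ (there (here (trans (⊕κ-flip (sym e)) (prove (:0 :+ v 0F) (v 0F) (κ ∷ [])))))) ∷ []) ∷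
        ((λ e → x∉ (there (here (sym e)))) ∷ (λ e → x∉ (here (trans (⊕κ-flip (sym e)) κ⊕κ≡𝟎))) ∷ []) ∷
        ((λ e → κ≢𝟎 (prove-from (v 1F) :0 (v 0F :+ v 1F) (v 0F) (x ∷ κ ∷ []) (sym e))) ∷ []) ∷ [] ∷ []
      to : ∀ {x p} → x ∈ˡ filter fst? (allFin n) → p ∈ˡ List.map (x ,_) (filter (snd? x) (allFin n)) →
        p ∈ˡ validPairs × x ∈ˡ proj₁ p ∷ []
      to {x} x∈ p∈ with x∉ ← proj₂ (∈-filter⁻ fst? {xs = allFin n} x∈) with y , y∈ , refl ← ∈-map⁻ (x ,_) p∈
        with y∉ ← proj₂ (∈-filter⁻ (snd? x) {xs = allFin n} y∈) =
        ∈-valid⁺ (valid (x∉ ∘ here) (x∉ ∘ there ∘ here) (y∉ ∘ here) (y∉ ∘ there ∘ here)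
          (λ e → y∉ (there (there (here (sym e))))) (λ e → y∉ (there (there (there (here (⊕κ-flip (sym e)))))))) , here refl
      from : ∀ {x p} → p ∈ˡ validPairs → x ∈ˡ proj₁ p ∷ [] →
        x ∈ˡ filter fst? (allFin n) × p ∈ˡ List.map (x ,_) (filter (snd? x) (allFin n))
      from {p = x , y} p∈ (here refl) with valid a b c d e f ← ∈-valid⁻ p∈ =
        ∈-filter⁺ fst? (∈-allFin x) (λ { (here q) → a q ; (there (here q)) → b q }) ,
        ∈-map⁺ (x ,_) (∈-filter⁺ (snd? x) (∈-allFin y)
          λ { (here q) → c q ; (there (here q)) → d q ; (there (there (here q))) → e (sym q)
            ; (there (there (there (here q)))) → f (⊕κ-flip (sym q)) })

  open Representatives _≟ₚ_ class using (reps)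

  class-refl : ∀ {p} → p ∈ˡ goodPairs → p ∈ˡ class p
  class-refl p∈ = ∈-class⁺ (∈-good⁻ p∈) (∼-refl _)

  class-closed : ∀ {p q} → p ∈ˡ goodPairs → q ∈ˡ class p → q ∈ˡ goodPairs
  class-closed p∈ q∈ = ∈-good⁺ (good-∼ (∈-good⁻ p∈) (Class₆.∈-class⁻ q∈))

  class-sym : ∀ {p q} → p ∈ˡ goodPairs → q ∈ˡ class p → p ∈ˡ class q
  class-sym {p} {q} p∈ q∈ = ∈-class⁺ {q} {p} (∈-good⁻ (class-closed p∈ q∈))
    (∼-sym {5} {p} {q} (period-6 (proj₂ (∈-good⁻ p∈))) (Class₆.∈-class⁻ q∈))

  class-trans : ∀ {p q r} → p ∈ˡ goodPairs → q ∈ˡ class p → r ∈ˡ class q → r ∈ˡ class p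
  class-trans {p} {q} {r} p∈ q∈ r∈ = ∈-class⁺ {p} {r} (∈-good⁻ p∈)
    (∼-trans {5} {p} (period-6 (proj₂ (∈-good⁻ p∈))) {q} {r} (Class₆.∈-class⁻ q∈) (Class₆.∈-class⁻ r∈))

  open Representatives.Partition _≟ₚ_ class goodPairs-unique class-refl class-closed class-sym class-trans

  #flat : ℕ
  #flat = length (reps goodPairs)

  #flat*12 : #flat * 12 ≡ length goodPairs
  #flat*12 = length-reps {12} good-class-unique (λ {p} _ → Class₆.length-class p)
    where
    good-class-unique : ∀ {p} → p ∈ˡ goodPairs → Unique (class p)
    good-class-unique {p} p∈ = Class₆.class-unique {p} (period-6 (proj₂ (∈-good⁻ p∈)))
      (first-injective (∈-good⁻ p∈)) next²-≢

  -- Both sides count the pairs (x , y) that form a triangle with 0; each hexagon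
  -- accounts for 12 of them.
  #flat-count : (octahedra : List (Fin n × Fin n)) → Unique octahedra →
    (∀ {p} → p ∈ˡ octahedra → Valid p × Octahedral p) → (∀ {p} → Valid p → Octahedral p → p ∈ˡ octahedra) →
    ∃[ a ] ∃[ b ] 2 + a ≡ n × 4 + b ≡ n × length octahedra + #flat * 12 ≡ a * b
  #flat-count os os-unique os⁻ os⁺ = let a , b , ea , eb , eab = length-validPairs in a , b , ea , eb , trans count (sym eab)
    where
    disjoint : ∀ {p} → ¬ (p ∈ˡ os × p ∈ˡ goodPairs)
    disjoint {p} (p∈os , p∈good) = proj₂ (∈-good⁻ {p} p∈good) (proj₂ (os⁻ p∈os))
    to : ∀ {p} → p ∈ˡ os ++ goodPairs → p ∈ˡ validPairs
    to {p} p∈ = Sum.[ (λ q → ∈-valid⁺ {p} (proj₁ (os⁻ q))) , (λ q → ∈-valid⁺ {p} (proj₁ (∈-good⁻ {p} q))) ]′ (∈-++⁻ os p∈)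
    from : ∀ {p} → p ∈ˡ validPairs → p ∈ˡ os ++ goodPairs
    from {p} p∈ = decide (Octahedral? p)
      where
      decide : Dec (Octahedral p) → p ∈ˡ os ++ goodPairs
      decide (yes o) = ∈-++⁺ˡ (os⁺ (∈-valid⁻ p∈) o)
      decide (no ¬o) = ∈-++⁺ʳ os (∈-good⁺ (∈-valid⁻ p∈ , ¬o))
    open ≡-Reasoning
    count : length os + #flat * 12 ≡ length validPairs
    count = begin
      length os + #flat * 12     ≡⟨ cong (length os +_) #flat*12 ⟩
      length os + length goodPairs ≡⟨ length-++ os {goodPairs} ⟨
      length (os ++ goodPairs)       ≡⟨ unique-length {xs = os ++ goodPairs} {ys = validPairs}
          (Unique.++⁺ {xs = os} {ys = goodPairs} os-unique goodPairs-unique disjoint)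
          validPairs-unique (λ {p} → to {p}) (λ {p} → from {p}) ⟩
      length validPairs              ∎

  rep-good : ∀ i → Good (rep i)
  rep-good i = ∈-good⁻ (rep∈ i)

  abstract
    flat : Fin #flat → SimplicialComplex n
    flat i = FlatSurface.K (rep i) (rep-good i)

    -- The index depends only on the class of (x , y), not on u, since all labels are base points.
    flat-unique : ∀ {u x y} → Good (x , y) → ∃! _≡_ λ i → Face (flat i) (triangleAt u x y)
    flat-unique {u} {x} {y} g = let i , p , uniq = rep-of (∈-good⁺ g) in
      i , FlatSurface.triangle-face (rep i) (rep-good i) _ (Class₆.∈-class⁻ p) ,
      λ {j} face → uniq (∈-class⁺ (rep-good j) (proj₂ (FlatSurface.triangle-face⁻ (rep j) (rep-good j) (proj₁ g) face)))

    flat⇒good : ∀ {u x y} i → Valid (x , y) → Face (flat i) (triangleAt u x y) → Good (x , y)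
    flat⇒good i val face = good-∼ (∈-good⁻ (rep∈ i)) (proj₂ (FlatSurface.triangle-face⁻ (rep i) (rep-good i) val face))

    flat-properties : ∀ i → IsClosedSurface (flat i) × VertexTransitive (flat i) ×
      χ (flat i) ≡ 0ℤ × #vertices (flat i) ≡ 2 * k
    flat-properties i = FlatSurface.isClosedSurface (rep i) (rep-good i) (𝟎 , _) , FlatSurface.vertexTransitive (rep i) (rep-good i) , FlatSurface.χ-K≡0 (rep i) (rep-good i) , FlatSurface.#vertices≡2k (rep i) (rep-good i)

    flat-≤-skel : ∀ i → flat i ≤ᶜ skel₂β k
    flat-≤-skel i = FlatSurface.≤-skel (rep i) (rep-good i)

-- Octahedra on the cosets of the subgroup of order 6

antipode : Fin 6 → Fin 6
antipode j = (3 + toℕ j) mod 6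

-- The quadrilateral 1, 2, 4, 5 in ℤ/6, the equator of the octahedron with poles 0 and 3; these are
-- the pairs that the rotation runs through from (1 , 2).
octahedron-links : Fin 4 → Fin 6 × Fin 6
octahedron-links 0F = 1F , 2F
octahedron-links 1F = 2F , 4F
octahedron-links 2F = 4F , 5F
octahedron-links 3F = 5F , 1F

-- A finite check that every pair forming a triangle with 0 in ℤ/6 is an edge of this quadrilateral
-- in one of its two directions; hence a single class contains all octahedral pairs.
octahedron-links-complete : ∀ i j →
  (i ≡ 0F ⊎ i ≡ 3F ⊎ j ≡ 0F ⊎ j ≡ 3F ⊎ i ≡ j ⊎ i ≡ antipode j) ⊎
  (∃ λ t → (i , j) ≡ octahedron-links t ⊎ (j , i) ≡ octahedron-links t)
octahedron-links-complete = from-yes (Fin.all? λ i → Fin.all? λ j →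
  (i Fin.≟ 0F ⊎-dec i Fin.≟ 3F ⊎-dec j Fin.≟ 0F ⊎-dec j Fin.≟ 3F ⊎-dec i Fin.≟ j ⊎-dec i Fin.≟ antipode j) ⊎-dec
  Fin.any? {n = 4} λ t → Product.≡-dec Fin._≟_ Fin._≟_ (i , j) (octahedron-links t) ⊎-dec Product.≡-dec Fin._≟_ Fin._≟_ (j , i) (octahedron-links t))

-- A facet of the octahedron takes one end of each of its three axes; the Boolean selects the end.
corner : Bool → Fin 3 → Fin 6
corner b t = if b then 3 ↑ʳ t else t ↑ˡ 3

-- The residue modulo 3 recovers the axis and is the same for antipodes.
corner-≢ : ∀ b b′ {s t} → s ≢ t → corner b s ≢ corner b′ t × corner b s ≢ antipode (corner b′ t)
corner-≢ b b′ {s} {t} s≢t =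
  (λ e → s≢t (trans (sym (axis-corner b s)) (trans (cong axis e) (axis-corner b′ t)))) ,
  (λ e → s≢t (trans (sym (axis-corner b s)) (trans (cong axis e) (trans (axis-antipode (corner b′ t)) (axis-corner b′ t)))))
  where
  axis : Fin 6 → Fin 3
  axis j = toℕ j mod 3
  axis-corner : ∀ b t → axis (corner b t) ≡ t
  axis-corner false 0F = refl
  axis-corner false 1F = refl
  axis-corner false 2F = refl
  axis-corner true  0F = refl
  axis-corner true  1F = refl
  axis-corner true  2F = refl
  axis-antipode : ∀ j → axis (antipode j) ≡ axis j
  axis-antipode = from-yes (Fin.all? λ j → axis (antipode j) Fin.≟ axis j)

module _ where
  open +-*-Solver

  double-triple : ∀ c → c * 3 + c * 3 ≡ 6 * c
  double-triple = solve 1 (λ c → c :* con 3 :+ c :* con 3 := con 6 :* c) refl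

  sixfold : ∀ a → (a + a + a) + (a + a + a) ≡ 6 * a
  sixfold = solve 1 (λ a → (a :+ a :+ a) :+ (a :+ a :+ a) := con 6 :* a) refl

  *-6-comm : ∀ q c → q * (6 * c) ≡ 6 * (q * c)
  *-6-comm = solve 2 (λ q c → q :* (con 6 :* c) := con 6 :* (q :* c)) refl

module Octahedra (k : ℕ) .{{_ : NonZero (k + k)}} (3≤k : 3 ≤ k) (c : ℕ) (k≡3c : k ≡ c * 3) where
  open CrossPolytope k 3≤k
  private
    n = k + k
  open IntegersMod n
  open Rotation isAbelianGroup Fin._≟_ κ κ⊕κ≡𝟎
  open Hexagon κ≢𝟎 torsion
  open AbelianGroupSolver isAbelianGroup

  private
    n≡6c : n ≡ 6 * c
    n≡6c = trans (cong₂ _+_ k≡3c k≡3c) (double-triple c)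
    instance
      c≢0 : NonZero c
      c≢0 = ℕ.≢-nonZero λ { refl → contradiction (subst (3 ≤_) k≡3c 3≤k) λ () }

  -- The multiples of c = k / 3: the subgroup of order 6.
  abstract
    M : ℕ → Fin n
    M a = ι (a * c)

    M-def : ∀ a → M a ≡ ι (a * c)
    M-def a = refl

    M-+ : ∀ a b → M a ⊕ M b ≡ M (a + b)
    M-+ a b = trans (ι-+ _ _) (cong ι (sym (ℕ.*-distribʳ-+ c a b)))

    M-0 : M 0 ≡ 𝟎
    M-0 = refl

    M-3 : M 3 ≡ κ
    M-3 = cong ι (trans (ℕ.*-comm 3 c) (sym k≡3c))

    M-% : ∀ a → M (a % 6) ≡ M a
    M-% a = ι-cong (sym (trans (%-congˡ a*c≡) (%-remove-+ʳ (a % 6 * c) (n∣m*n (a / 6)))))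
      where
      a*c≡ : a * c ≡ a % 6 * c + a / 6 * n
      a*c≡ = trans (cong (_* c) (m≡m%n+[m/n]*n a 6)) (trans (ℕ.*-distribʳ-+ c (a % 6) (a / 6 * 6))
        (cong (a % 6 * c +_) (trans (ℕ.*-assoc (a / 6) 6 c) (cong (a / 6 *_) (sym n≡6c)))))

    M-injective : ∀ {a b} → a < 6 → b < 6 → M a ≡ M b → a ≡ b
    M-injective {a} {b} a<6 b<6 eq = ℕ.*-cancelʳ-≡ a b c
      (trans (sym (toℕ-ι-< (small a<6))) (trans (cong toℕ eq) (toℕ-ι-< (small b<6))))
      where
      small : ∀ {a} → a < 6 → a * c < n
      small {a} a<6 = subst (a * c <_) (sym n≡6c) (ℕ.*-monoˡ-< c a<6)

    -- From 6t = q n = 6 q c follows t = q c, and q < 6 because t < n = 6c.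
    6×≡𝟎⇒M : ∀ {x} → 6× x ≡ 𝟎 → ∃ λ (j : Fin 6) → x ≡ M (toℕ j)
    6×≡𝟎⇒M {x} eq = fromℕ< q<6 , trans (sym (ι-toℕ x)) (cong ι (trans t≡ (cong (_* c) (sym (Fin.toℕ-fromℕ< q<6)))))
      where
      t q : ℕ
      t = toℕ x
      n∣6t : n ∣ (t + t + t) + (t + t + t)
      n∣6t = 6×≡𝟎⇒∣ eq
      q = _∣_.quotient n∣6t
      t≡ : t ≡ q * c
      t≡ = ℕ.*-cancelˡ-≡ t (q * c) 6 (trans
        (sym (sixfold t))
        (trans (_∣_.equality n∣6t) (trans (cong (q *_) n≡6c)(*-6-comm q c))))
      q<6 : q < 6
      q<6 = ℕ.*-cancelʳ-< c q 6 (subst₂ _<_ t≡ n≡6c (Fin.toℕ<n x))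

  M-≢ : ∀ a b {a<6 : True (a ℕ.<? 6)} {b<6 : True (b ℕ.<? 6)} {a≢b : False (a ℕ.≟ b)} → M a ≢ M b
  M-≢ a b {a<6} {b<6} {a≢b} eq = toWitnessFalse a≢b (M-injective (toWitness a<6) (toWitness b<6) eq)

  μ : Fin 6 → Fin n
  μ j = M (toℕ j)

  μ-injective : ∀ {i j} → μ i ≡ μ j → i ≡ j
  μ-injective {i} {j} eq = Fin.toℕ-injective (M-injective (Fin.toℕ<n i) (Fin.toℕ<n j) eq)

  M-⊕κ : ∀ a → M a ⊕ κ ≡ M (a + 3)
  M-⊕κ a = trans (cong (M a ⊕_) (sym M-3)) (M-+ a 3)

  μ-antipode : ∀ j → μ (antipode j) ≡ μ j ⊕ κ
  μ-antipode j = trans (cong M (Fin.toℕ-fromℕ< (m%n<n (3 + toℕ j) 6))) (trans (M-% (3 + toℕ j))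
    (trans (cong M (ℕ.+-comm 3 (toℕ j))) (sym (M-⊕κ (toℕ j)))))

  M-─ : ∀ a b → M (a + b) ─ M a ≡ M b
  M-─ a b = trans (cong (_─ M a) (sym (M-+ a b))) (prove ((v 0F :+ v 1F) :- v 0F) (v 1F) (M a ∷ M b ∷ []))

  6×-⊕ : ∀ x y → 6× (x ⊕ y) ≡ 6× x ⊕ 6× y
  6×-⊕ x y = prove (:6 (v 0F :+ v 1F)) (:6 (v 0F) :+ :6 (v 1F)) (x ∷ y ∷ [])

  6×-─ : ∀ {x y} → 6× x ≡ 𝟎 → 6× y ≡ 𝟎 → 6× (x ─ y) ≡ 𝟎
  6×-─ {x} {y} a b = trans (6×-⊕ x (⊖ y)) (trans (cong₂ _⊕_ a (6×-neg b)) (prove (:0 :+ :0) :0 (x ∷ [])))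

  6×-M : ∀ a → 6× (M a) ≡ 𝟎
  6×-M a = trans (cong₂ _⊕_ 3×-M 3×-M) (trans (M-+ _ _) (trans (sym (M-% _)) (trans (cong M 6a%6≡0) M-0)))
    where
    3×-M : 3× (M a) ≡ M (a + a + a)
    3×-M = trans (cong (_⊕ M a) (M-+ a a)) (M-+ (a + a) a)
    6a%6≡0 : ((a + a + a) + (a + a + a)) % 6 ≡ 0
    6a%6≡0 = trans (%-congˡ (trans (sixfold a) (ℕ.*-comm 6 a)))
      (%-remove-+ʳ 0 (n∣m*n a))

  p₀ : Fin n × Fin n
  p₀ = M 1 , M 2

  ρ-M-double : ∀ a → ρ (M a , M (a + a)) ≡ (M (a + a) , M (a + 3))
  ρ-M-double a = cong (M (a + a) ,_) (trans (apex-double (sym (M-+ a a))) (M-⊕κ a))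

  fold-p₀-2 : fold p₀ ρ 2 ≡ (M 4 , M 5)
  fold-p₀-2 = trans (cong ρ (ρ-M-double 1)) (ρ-M-double 2)

  fold-p₀-3 : fold p₀ ρ 3 ≡ (M 5 , M 1)
  fold-p₀-3 = trans (cong ρ fold-p₀-2) (cong (M 5 ,_) (trans
    -- In ℤ/6 twice 4 is 2, not 5, so this step is a reflection, unlike the two antipodal ones
    -- before it.
    (apex-generic λ e → M-≢ 5 2 (trans e (trans (M-+ 4 4) (sym (M-% 8))))) (M-─ 4 1)))

  fold-p₀ : ∀ t → fold p₀ ρ (toℕ t) ≡ (μ (proj₁ (octahedron-links t)) , μ (proj₂ (octahedron-links t)))
  fold-p₀ 0F = refl
  fold-p₀ 1F = ρ-M-double 1
  fold-p₀ 2F = fold-p₀-2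
  fold-p₀ 3F = fold-p₀-3

  period-p₀ : fold p₀ ρ 4 ≡ p₀
  period-p₀ = trans (cong ρ fold-p₀-3) (cong (M 1 ,_) (trans
    -- Twice 5 is 4, not 1, so the step is again a reflection; 1 - 5 is evaluated as 7 - 5.
    (apex-generic λ e → M-≢ 1 4 (trans e (trans (M-+ 5 5) (sym (M-% 10)))))
    (trans (cong (_─ M 5) (M-% 7)) (M-─ 5 2))))

  valid-p₀ : Valid p₀
  valid-p₀ = valid (λ e → M-≢ 1 0 (trans e (sym M-0))) (λ e → M-≢ 1 3 (trans e (sym M-3)))
    (λ e → M-≢ 2 0 (trans e (sym M-0))) (λ e → M-≢ 2 3 (trans e (sym M-3)))
    (M-≢ 1 2) (λ e → M-≢ 1 5 (trans e (M-⊕κ 2)))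

  first-p₀ : ∀ (t : Fin 4) → first p₀ (toℕ t) ≡ μ (proj₁ (octahedron-links t))
  first-p₀ t = cong proj₁ (fold-p₀ t)

  first-p₀-injective : ∀ {i j : Fin 4} → first p₀ (toℕ i) ≡ first p₀ (toℕ j) → i ≡ j
  first-p₀-injective {i} {j} eq = links-injective i j
    (μ-injective (trans (sym (first-p₀ i)) (trans eq (first-p₀ j))))
    where
    links-injective : ∀ i j → proj₁ (octahedron-links i) ≡ proj₁ (octahedron-links j) → i ≡ j
    links-injective = from-yes (Fin.all? λ i → Fin.all? λ j →
      (proj₁ (octahedron-links i) Fin.≟ proj₁ (octahedron-links j)) →-dec (i Fin.≟ j))

  octahedral-∼ : ∀ {q} → p₀ ∼ q → Octahedral q
  octahedral-∼ (j , inj₁ refl) = octahedral-fold j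
    where
    octahedral-fold : ∀ j → Octahedral (fold p₀ ρ j)
    octahedral-fold zero    = 6×-M 1 , 6×-M 2
    octahedral-fold (suc j) = octahedral-ρ (octahedral-fold j)
  octahedral-∼ (j , inj₂ refl) = octahedral-swap (octahedral-∼ (j , inj₁ refl))

  octahedral⇒∼ : ∀ {x y} → Valid (x , y) → Octahedral (x , y) → p₀ ∼ (x , y)
  octahedral⇒∼ {x} {y} val (6x≡𝟎 , 6y≡𝟎) = go (6×≡𝟎⇒M 6x≡𝟎) (6×≡𝟎⇒M 6y≡𝟎)
    where
    go : ∃ (λ i → x ≡ μ i) → ∃ (λ j → y ≡ μ j) → p₀ ∼ (x , y)
    go (i , x≡) (j , y≡) with octahedron-links-complete i j
    ... | inj₁ (inj₁ refl) = contradiction (trans x≡ M-0) (Valid.x≢𝟎 val)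
    ... | inj₁ (inj₂ (inj₁ refl)) = contradiction (trans x≡ M-3) (Valid.x≢κ val)
    ... | inj₁ (inj₂ (inj₂ (inj₁ refl))) = contradiction (trans y≡ M-0) (Valid.y≢𝟎 val)
    ... | inj₁ (inj₂ (inj₂ (inj₂ (inj₁ refl)))) = contradiction (trans y≡ M-3) (Valid.y≢κ val)
    ... | inj₁ (inj₂ (inj₂ (inj₂ (inj₂ (inj₁ refl))))) = contradiction (trans x≡ (sym y≡)) (Valid.x≢y val)
    ... | inj₁ (inj₂ (inj₂ (inj₂ (inj₂ (inj₂ refl))))) =
      contradiction (trans x≡ (trans (μ-antipode j) (cong (_⊕ κ) (sym y≡)))) (Valid.x≢y+κ val)
    ... | inj₂ (t , inj₁ e) = toℕ t , inj₁ (trans (cong₂ _,_ x≡ y≡)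
      (trans (cong (λ q → μ (proj₁ q) , μ (proj₂ q)) e) (sym (fold-p₀ t))))
    ... | inj₂ (t , inj₂ e) = toℕ t , inj₂ (cong swap (trans (cong₂ _,_ y≡ x≡)
      (trans (cong (λ q → μ (proj₁ q) , μ (proj₂ q)) e) (sym (fold-p₀ t)))))

  -- Membership in the coset of i modulo the 6-torsion, stated as an equation so that it is
  -- decidable and its closure properties are linear identities.
  InCoset : Fin c → Fin n → Set
  InCoset i u = 6× (u ─ ι (toℕ i)) ≡ 𝟎

  coset-translate : ∀ {i u x y} → InCoset i u → InCoset i x → InCoset i y → InCoset i (u ⊕ (y ─ x))
  coset-translate {i} {u} {x} {y} a b d = trans
    (cong 6× (prove ((v 0F :+ (v 2F :- v 1F)) :- v 3F) ((v 0F :- v 3F) :+ ((v 2F :- v 3F) :- (v 1F :- v 3F))) (u ∷ x ∷ y ∷ ι (toℕ i) ∷ [])))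
    (trans (6×-⊕ _ _) (trans (cong₂ _⊕_ a (6×-─ d b)) (prove (:0 :+ :0) :0 (x ∷ []))))

  coset-⊕ : ∀ {i u x} → InCoset i u → 6× x ≡ 𝟎 → InCoset i (u ⊕ x)
  coset-⊕ {i} {u} {x} a b = trans (cong 6× (prove ((v 0F :+ v 1F) :- v 2F) ((v 0F :- v 2F) :+ v 1F) (u ∷ x ∷ ι (toℕ i) ∷ [])))
    (trans (6×-⊕ _ _) (trans (cong₂ _⊕_ a b) (prove (:0 :+ :0) :0 (x ∷ []))))

  corner-vertex : Fin c → Fin 6 → Fin n
  corner-vertex i j = ι (toℕ i) ⊕ μ j

  coset-corner : ∀ i j → InCoset i (corner-vertex i j)
  coset-corner i j = trans (cong 6× (prove ((v 0F :+ v 1F) :- v 0F) (v 1F) (ι (toℕ i) ∷ μ j ∷ []))) (6×-M (toℕ j))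

  coset⇒corner : ∀ {i u} → InCoset i u → ∃ λ j → u ≡ corner-vertex i j
  coset⇒corner {i} {u} a = let j , e = 6×≡𝟎⇒M a in
    j , trans (prove (v 0F) (v 1F :+ (v 0F :- v 1F)) (u ∷ ι (toℕ i) ∷ [])) (cong (ι (toℕ i) ⊕_) e)

  -- An element of coset i is i + j c modulo 6c, so its residue modulo c is i.
  coset-unique : ∀ {i i′ u} → InCoset i u → InCoset i′ u → i ≡ i′
  coset-unique {i} {i′} {u} a b = Fin.toℕ-injective (trans (sym (residue i j)) (trans (cong (_% c) eq%) (residue i′ j′)))
    where
    open ≡-Reasoning
    j j′ : Fin 6
    j = proj₁ (coset⇒corner {i} a)
    j′ = proj₁ (coset⇒corner {i′} b)
    value : ∀ i (j : Fin 6) → corner-vertex i j ≡ ι (toℕ i + toℕ j * c)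
    value i j = trans (cong (ι (toℕ i) ⊕_) (M-def (toℕ j))) (ι-+ _ _)
    eq% : (toℕ i + toℕ j * c) % n ≡ (toℕ i′ + toℕ j′ * c) % n
    eq% = ι-≡⇒% (trans (sym (value i j)) (trans (sym (proj₂ (coset⇒corner {i} a)))
      (trans (proj₂ (coset⇒corner {i′} b)) (value i′ j′))))
    residue : ∀ (i : Fin c) (j : Fin 6) → (toℕ i + toℕ j * c) % n % c ≡ toℕ i
    residue i j = begin
      (toℕ i + toℕ j * c) % n % c ≡⟨ m∣n⇒o%n%m≡o%m c n (toℕ i + toℕ j * c) (divides 6 n≡6c) ⟩
      (toℕ i + toℕ j * c) % c     ≡⟨ %-remove-+ʳ (toℕ i) {d = c} (n∣m*n (toℕ j)) ⟩
      toℕ i % c                       ≡⟨ m<n⇒m%n≡m (Fin.toℕ<n i) ⟩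
      toℕ i                           ∎

  coset-of : ∀ u → ∃ λ i → InCoset i u
  coset-of u = i , trans (cong 6× difference) (6×-M (toℕ u / c))
    where
    i : Fin c
    i = toℕ u mod c
    u≡ : u ≡ ι (toℕ i) ⊕ M (toℕ u / c)
    u≡ = trans (sym (ι-toℕ u)) (trans (cong ι (trans (m≡m%n+[m/n]*n (toℕ u) c)
      (cong (_+ toℕ u / c * c) (sym (Fin.toℕ-fromℕ< (m%n<n (toℕ u) c))))))
      (trans (sym (ι-+ _ _)) (cong (ι (toℕ i) ⊕_) (sym (M-def (toℕ u / c))))))
    difference : u ─ ι (toℕ i) ≡ M (toℕ u / c)
    difference = prove-from (v 0F :- v 1F) (v 2F) (v 0F) (v 1F :+ v 2F) (u ∷ ι (toℕ i) ∷ M (toℕ u / c) ∷ []) u≡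

  module Octahedron (i : Fin c) where
    -- The argument 1 makes the polygon a quadrilateral. Restricting the base points to one coset
    -- isolates a single octahedron.
    open OrbitSurface {X = InCoset i} (λ u → _ Fin.≟ 𝟎) 1 p₀ period-p₀ valid-p₀ first-p₀-injective
      (λ {u} j Xu → coset-⊕ {i} Xu (proj₁ (octahedral-∼ (toℕ j , inj₁ refl))))
      (λ {u} → coset-translate {i} {u}) public

    closedSurface : IsClosedSurface K
    closedSurface = isClosedSurface (corner-vertex i 0F , coset-corner i 0F)

    corner-injective : ∀ {j j′} → corner-vertex i j ≡ corner-vertex i j′ → j ≡ j′
    corner-injective {j} {j′} eq = μ-injective
      (prove-from (v 1F) (v 2F) (v 0F :+ v 1F) (v 0F :+ v 2F) (ι (toℕ i) ∷ μ j ∷ μ j′ ∷ []) eq)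

    #vertices≡6 : #vertices K ≡ 6
    #vertices≡6 = Count.#vertices≡ {vs = tabulate (corner-vertex i)} (Unique.tabulate⁺ corner-injective) to from
      where
      to : ∀ {u} → InCoset i u → u ∈ˡ tabulate (corner-vertex i)
      to {u} Xu = let j , e = coset⇒corner {i} {u} Xu in subst (_∈ˡ _) (sym e) (∈-tabulate⁺ {f = corner-vertex i} j)
      from : ∀ {u} → u ∈ˡ tabulate (corner-vertex i) → InCoset i u
      from u∈ = let j , e = ∈-tabulate⁻ {f = corner-vertex i} u∈ in subst (InCoset i) (sym e) (coset-corner i j)

    label : Fin n → Fin 6
    label u with Fin.any? (λ j → u Fin.≟ corner-vertex i j)
    ... | yes (j , _) = j
    -- An arbitrary value for labels outside the coset, which are not vertices here.
    ... | no  _       = 0F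

    corner-label : ∀ {u} → InCoset i u → corner-vertex i (label u) ≡ u
    corner-label {u} Xu with Fin.any? (λ j → u Fin.≟ corner-vertex i j)
    ... | yes (j , e) = sym e
    ... | no ∄        = contradiction (coset⇒corner {i} Xu) ∄

    label-corner : ∀ j → label (corner-vertex i j) ≡ j
    label-corner j = corner-injective (corner-label (coset-corner i j))

    -- A diagonal t, 3 + t in the image comes from vertices that differ by 3c = κ, and a face of the
    -- surface contains no antipodes.
    to-face : ∀ F → Face K F → Face (∂β 3) (image label F)
    to-face F face = diagonal-free⇒face λ t d →
      let x , x∈ , ex = ∈-image⁻ {f = label} {F} (d (x∈p∪q⁺ (inj₁ (x∈⁅x⁆ (t ↑ˡ 3)))))
          y , y∈ , ey = ∈-image⁻ {f = label} {F} (d (x∈p∪q⁺ (inj₂ (x∈⁅x⁆ (3 ↑ʳ t)))))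
      in face⇒antipode-free′ face x∈ (subst (_∈ F) (opposite t (at x∈ ex) (at y∈ ey)) y∈)
      where
      at : ∀ {u j} → u ∈ F → label u ≡ j → u ≡ corner-vertex i j
      at {u} u∈ e = trans (sym (corner-label (vertex⇒X (down-closed K (λ p → subst (_∈ F) (sym (x∈⁅y⁆⇒x≡y u p)) u∈) face))))
        (cong (corner-vertex i) e)
      opposite : ∀ t {x y} → x ≡ corner-vertex i (t ↑ˡ 3) → y ≡ corner-vertex i (3 ↑ʳ t) → y ≡ x ⊕ κ
      opposite t refl refl = trans (cong (ι (toℕ i) ⊕_) (trans (cong M (trans (Fin.toℕ-↑ʳ 3 t)
          (trans (ℕ.+-comm 3 (toℕ t)) (cong (_+ 3) (sym (Fin.toℕ-↑ˡ t 3)))))) (sym (M-⊕κ (toℕ (t ↑ˡ 3))))))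
        (prove (v 0F :+ (v 1F :+ v 2F)) ((v 0F :+ v 1F) :+ v 2F) (ι (toℕ i) ∷ μ (t ↑ˡ 3) ∷ κ ∷ []))

    -- F lies in the facet that takes the upper end of an axis if F contains it and the lower end
    -- otherwise. Seen from its corner on axis 0, this facet is a valid pair of 6-torsion
    -- differences, hence in the orbit of `p₀`.
    from-face : ∀ F → Face (∂β 3) F → Face K (image (corner-vertex i) F)
    from-face F face = down-closed K (image-⊆ {f = corner-vertex i} {F} λ x∈ → in-triangle (facet x∈))
      (triangle-face (coset-corner i (cr 0F)) (octahedral⇒∼
        (valid-differences (apart λ ()) (apart λ ()) (apart λ ()) (nonopposite λ ()) (nonopposite λ ()) (nonopposite λ ()))
        (6×-─ (6×-M _) (6×-M _) , 6×-─ (6×-M _) (6×-M _))))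
      where
      cr : Fin 3 → Fin 6
      cr t = corner (does (3 ↑ʳ t ∈? F)) t
      facet : ∀ {x} → x ∈ F → ∃ λ t → x ≡ cr t
      facet {x} x∈ with half {3} x
      ... | lower t with 3 ↑ʳ t ∈? F
      ...   | yes q = ⊥-elim (face⇒diagonal-free {3} face t (diagonal-⊆ {3} {t} x∈ q))
      ...   | no ¬q = t , lower-corner ¬q
        where
        lower-corner : (3 ↑ʳ t) ∉ F → t ↑ˡ 3 ≡ cr t
        lower-corner ¬q with 3 ↑ʳ t ∈? F
        ... | yes q = contradiction q ¬q
        ... | no _  = refl
      facet {x} x∈ | upper t = t , upper-corner
        where
        upper-corner : 3 ↑ʳ t ≡ cr t
        upper-corner with 3 ↑ʳ t ∈? F
        ... | yes _ = refl
        ... | no ¬q = contradiction x∈ ¬q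
      apart : ∀ {s t} → s ≢ t → μ (cr s) ≢ μ (cr t)
      apart {s} {t} s≢t e = proj₁ (corner-≢ (does (3 ↑ʳ s ∈? F)) (does (3 ↑ʳ t ∈? F)) s≢t) (μ-injective e)
      nonopposite : ∀ {s t} → s ≢ t → μ (cr s) ≢ μ (cr t) ⊕ κ
      nonopposite {s} {t} s≢t e = proj₂ (corner-≢ (does (3 ↑ʳ s ∈? F)) (does (3 ↑ʳ t ∈? F)) s≢t) (μ-injective (trans e (sym (μ-antipode (cr t)))))
      shift : ∀ j → corner-vertex i j ≡ corner-vertex i (cr 0F) ⊕ (μ j ─ μ (cr 0F))
      shift j = prove (v 0F :+ v 1F) ((v 0F :+ v 2F) :+ (v 1F :- v 2F)) (ι (toℕ i) ∷ μ j ∷ μ (cr 0F) ∷ [])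
      in-triangle : ∀ {x} → ∃ (λ t → x ≡ cr t) →
        corner-vertex i x ∈ triangleAt (corner-vertex i (cr 0F)) (μ (cr 1F) ─ μ (cr 0F)) (μ (cr 2F) ─ μ (cr 0F))
      in-triangle (0F , refl) = ∈-setOf⁺ (here refl)
      in-triangle (1F , refl) = ∈-setOf⁺ (there (here (shift (cr 1F))))
      in-triangle (2F , refl) = ∈-setOf⁺ (there (there (here (shift (cr 2F)))))

    isOctahedron : K ≅ ∂β 3
    isOctahedron = record
      { to        = label
      ; from      = corner-vertex i
      ; to-face   = to-face
      ; from-face = from-face
      ; from∘to   = λ u vert → corner-label (vertex⇒X vert)
      ; to∘from   = λ j _ → label-corner j
      }

-- Reindexing and solving for the number of surfaces

DecomposesInto-reindex : ∀ {n} {I J : Set} {K : SimplicialComplex n} {S : I → SimplicialComplex n}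
  (f : J → I) (g : I → J) → (∀ i → f (g i) ≡ i) → (∀ j → g (f j) ≡ j) →
  DecomposesInto K S → DecomposesInto K (S ∘ f)
DecomposesInto-reindex {S = S} f g fg gf (sub , uniq) = sub ∘ f , λ F face ∣F∣≡3 →
  let i , Fi , i-unique = uniq F face ∣F∣≡3 in
  g i , subst (λ i → Face (S i) F) (sym (fg i)) Fi , λ {j} Fj → trans (cong g (i-unique Fj)) (gf j)

module _ where
  open +-*-Solver

  third : ∀ e t → t * 12 ≡ 4 * e → e / 3 ≡ t
  third e t eq = trans (cong (_/ 3) (sym t*3≡e)) (m*n/n≡m t 3)
    where
    t*3≡e : t * 3 ≡ e
    t*3≡e = ℕ.*-cancelˡ-≡ (t * 3) e 4 (trans (solve 1 (λ t → con 4 :* (t :* con 3) := t :* con 12) refl t) eq)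

  -- The product is (2k - 2)(2k - 4) = 4(k - 1)(k - 2); matching k as j + 2 turns truncated
  -- differences into sums.
  flat-count : ∀ {k a b t} → 2 ≤ k → 2 + a ≡ k + k → 4 + b ≡ k + k → t * 12 ≡ a * b → (k ∸ 1) * (k ∸ 2) / 3 ≡ t
  flat-count {suc (suc j)} {a} {b} {t} (s≤s (s≤s z≤n)) ea eb e = third (suc j * j) t (trans e (trans (cong₂ _*_ a≡ b≡)
    (solve 1 (λ j → (con 2 :+ (j :+ j)) :* (j :+ j) := con 4 :* ((con 1 :+ j) :* j)) refl j)))
    where
    k+k : suc (suc j) + suc (suc j) ≡ 4 + (j + j)
    k+k = solve 1 (λ j → (con 2 :+ j) :+ (con 2 :+ j) := con 4 :+ (j :+ j)) refl j
    a≡ : a ≡ 2 + (j + j)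
    a≡ = ℕ.+-cancelˡ-≡ 2 _ _ (trans ea k+k)
    b≡ : b ≡ j + j
    b≡ = ℕ.+-cancelˡ-≡ 4 _ _ (trans eb k+k)

  -- Here (2k - 2)(2k - 4) - 8 = 4k(k - 3), where 8 is the number of octahedral pairs.
  flat-count-octahedral : ∀ {k a b t} → 3 ≤ k → 2 + a ≡ k + k → 4 + b ≡ k + k → 8 + t * 12 ≡ a * b → k * (k ∸ 3) / 3 ≡ t
  flat-count-octahedral {suc (suc (suc j))} {a} {b} {t} (s≤s (s≤s (s≤s z≤n))) ea eb e = third (suc (suc (suc j)) * j) t
    (ℕ.+-cancelˡ-≡ 8 (t * 12) (4 * (suc (suc (suc j)) * j)) (trans e (trans (cong₂ _*_ a≡ b≡)
      (solve 1 (λ j → (con 4 :+ (j :+ j)) :* (con 2 :+ (j :+ j)) := con 8 :+ con 4 :* ((con 3 :+ j) :* j)) refl j))))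
    where
    k+k : suc (suc (suc j)) + suc (suc (suc j)) ≡ 6 + (j + j)
    k+k = solve 1 (λ j → (con 3 :+ j) :+ (con 3 :+ j) := con 6 :+ (j :+ j)) refl j
    a≡ : a ≡ 4 + (j + j)
    a≡ = ℕ.+-cancelˡ-≡ 2 _ _ (trans ea k+k)
    b≡ : b ≡ 2 + (j + j)
    b≡ = ℕ.+-cancelˡ-≡ 4 _ _ (trans eb k+k)

IsFlatSurface : (k : ℕ) → SimplicialComplex (k + k) → Set
IsFlatSurface k K = IsClosedSurface K × VertexTransitive K × χ K ≡ 0ℤ × #vertices K ≡ 2 * k

Surfaces FlatSurfaces : ℕ → ℕ → Set₁
Surfaces k m = Σ (Fin m → SimplicialComplex (k + k)) λ S →
  DecomposesInto (skel₂β k) S × (∀ i → IsClosedSurface (S i) × VertexTransitive (S i))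
FlatSurfaces k m = Σ (Fin m → SimplicialComplex (k + k)) λ S →
  DecomposesInto (skel₂β k) S × (∀ i → IsFlatSurface k (S i))

OctahedraAndFlatSurfaces : ℕ → ℕ → ℕ → Set₁
OctahedraAndFlatSurfaces k c m =
  Σ (Fin c → SimplicialComplex (k + k)) λ O → Σ (Fin m → SimplicialComplex (k + k)) λ S →
    DecomposesInto (skel₂β k) [ O , S ] × VertexDisjoint O ×
    (∀ i → (O i ≅ ∂β 3) × #vertices (O i) ≡ 6) × (∀ i → IsFlatSurface k (S i))

FlatSurfaces⇒Surfaces : ∀ {k m} → FlatSurfaces k m → Surfaces k m
FlatSurfaces⇒Surfaces (S , decomposes , flat-surfaces) = S , decomposes , λ i → proj₁ (flat-surfaces i) , proj₁ (proj₂ (flat-surfaces i))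

-- Assembly according to divisibility of k by 3

module NonMultipleOf3 (k : ℕ) .{{_ : NonZero (k + k)}} (3≤k : 3 ≤ k) (3∤k : ¬ 3 ∣ k) where
  open CrossPolytope k 3≤k
  open IntegersMod (k + k)
  open Rotation isAbelianGroup Fin._≟_ κ κ⊕κ≡𝟎
  open Hexagon κ≢𝟎 torsion
  open Decomposition k 3≤k

  -- If 6t = q · 2k, then 3t = q k; as 3 is prime and does not divide k, it divides q, and t is a
  -- multiple of k.
  6-torsion : ∀ {x} → 6× x ≡ 𝟎 → x ≡ 𝟎 ⊎ x ≡ κ
  6-torsion {x} eq = [ (λ (divides r q≡) → multiple-of-k {x} {r} (ℕ.*-cancelˡ-≡ t (r * k) 3
                         (trans 3t≡ (trans (cong (_* k) (trans q≡ (ℕ.*-comm r 3))) (ℕ.*-assoc 3 r k)))))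
                     , (λ 3∣k → ⊥-elim (3∤k 3∣k)) ]
    (euclidsLemma q k (from-yes (prime? 3)) (divides t (trans (sym 3t≡) (ℕ.*-comm 3 t))))
    where
    open _∣_ (6×≡𝟎⇒∣ eq) renaming (quotient to q; equality to 6t≡)
    t : ℕ
    t = toℕ x
    3t≡ : 3 * t ≡ q * k
    3t≡ = ℕ.*-cancelˡ-≡ (3 * t) (q * k) 2 (trans
      (solve 1 (λ t → con 2 :* (con 3 :* t) := (t :+ t :+ t) :+ (t :+ t :+ t)) refl t)
      (trans 6t≡ (solve 2 (λ q k → q :* (k :+ k) := con 2 :* (q :* k)) refl q k)))
      where open +-*-Solver

  ¬octahedral : ∀ {p} → Valid p → ¬ Octahedral p
  ¬octahedral val (6x≡𝟎 , _) = [ Valid.x≢𝟎 val , Valid.x≢κ val ] (6-torsion 6x≡𝟎)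

  decomposition : DecomposesInto (skel₂β k) flat
  decomposition = flat-≤-skel , λ F (face , _) ∣F∣≡3 →
    let u , x , y , val , F≡ = triangle-view face ∣F∣≡3 in
    subst (λ F → ∃! _≡_ λ i → Face (flat i) F) (sym F≡) (flat-unique (val , ¬octahedral val))

  #flat≡ : (k ∸ 1) * (k ∸ 2) / 3 ≡ #flat
  #flat≡ = let a , b , ea , eb , e = #flat-count [] [] (λ ()) (λ val oct → ⊥-elim (¬octahedral val oct)) in
    flat-count (ℕ.≤-trans (s≤s (s≤s z≤n)) 3≤k) ea eb e

  flat-surfaces : FlatSurfaces k ((k ∸ 1) * (k ∸ 2) / 3)
  flat-surfaces = subst (FlatSurfaces k) (sym #flat≡) (flat , decomposition , flat-properties)

module MultipleOf3 (k : ℕ) .{{_ : NonZero (k + k)}} (3≤k : 3 ≤ k) (c : ℕ) (k≡3c : k ≡ c * 3) where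
  open CrossPolytope k 3≤k
  open IntegersMod (k + k)
  open Rotation isAbelianGroup Fin._≟_ κ κ⊕κ≡𝟎
  open Hexagon κ≢𝟎 torsion
  open Decomposition k 3≤k
  open Octahedra k 3≤k c k≡3c

  abstract
    octahedron : Fin c → SimplicialComplex (k + k)
    octahedron i = Octahedron.K i

    octahedron-≤-skel : ∀ i → octahedron i ≤ᶜ skel₂β k
    octahedron-≤-skel i = Octahedron.≤-skel i

    octahedron-face⁺ : ∀ i {u x y} → InCoset i u → p₀ ∼ (x , y) → Face (octahedron i) (triangleAt u x y)
    octahedron-face⁺ i = Octahedron.triangle-face i

    octahedron-face⁻ : ∀ i {u x y} → Valid (x , y) → Face (octahedron i) (triangleAt u x y) → InCoset i u × p₀ ∼ (x , y)
    octahedron-face⁻ i = Octahedron.triangle-face⁻ i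

    octahedron-vertex : ∀ i {u} → IsVertex (octahedron i) u → InCoset i u
    octahedron-vertex i = Octahedron.vertex⇒X i

    octahedron-surface : ∀ i → IsClosedSurface (octahedron i) × VertexTransitive (octahedron i)
    octahedron-surface i = Octahedron.closedSurface i , Octahedron.vertexTransitive i

    octahedron-properties : ∀ i → (octahedron i ≅ ∂β 3) × #vertices (octahedron i) ≡ 6
    octahedron-properties i = Octahedron.isOctahedron i , Octahedron.#vertices≡6 i

  -- Being octahedral is constant on orbits and so rules out the hexagonal surfaces; among the
  -- octahedra the coset of u decides.
  octahedron-unique : ∀ {u x y} → Valid (x , y) → Octahedral (x , y) →
    ∃! _≡_ λ s → Face ([ octahedron , flat ] s) (triangleAt u x y)
  octahedron-unique {u} {x} {y} val oct = inj₁ i , octahedron-face⁺ i u∈ (octahedral⇒∼ val oct) , unique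
    where
    i = proj₁ (coset-of u)
    u∈ = proj₂ (coset-of u)
    unique : ∀ {s} → Face ([ octahedron , flat ] s) (triangleAt u x y) → inj₁ i ≡ s
    unique {inj₁ j} face = cong inj₁ (coset-unique {i} {j} {u} u∈ (proj₁ (octahedron-face⁻ j val face)))
    unique {inj₂ j} face = ⊥-elim (proj₂ (flat⇒good j val face) oct)

  flat-unique′ : ∀ {u x y} → Good (x , y) → ∃! _≡_ λ s → Face ([ octahedron , flat ] s) (triangleAt u x y)
  flat-unique′ {u} {x} {y} good = inj₂ (proj₁ found) , proj₁ (proj₂ found) , unique
    where
    found = flat-unique {u} good
    unique : ∀ {s} → Face ([ octahedron , flat ] s) (triangleAt u x y) → inj₂ (proj₁ found) ≡ s
    unique {inj₁ j} face = ⊥-elim (proj₂ good (octahedral-∼ (proj₂ (octahedron-face⁻ j (proj₁ good) face))))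
    unique {inj₂ j} face = cong inj₂ (proj₂ (proj₂ found) face)

  decomposition : DecomposesInto (skel₂β k) [ octahedron , flat ]
  decomposition = (λ { (inj₁ i) → octahedron-≤-skel i ; (inj₂ i) → flat-≤-skel i }) , λ F (face , _) ∣F∣≡3 →
    let u , x , y , val , F≡ = triangle-view face ∣F∣≡3 in
    subst (λ F → ∃! _≡_ λ s → Face ([ octahedron , flat ] s) F) (sym F≡) (unique val (Octahedral? (x , y)))
    where
    unique : ∀ {u x y} → Valid (x , y) → Dec (Octahedral (x , y)) →
      ∃! _≡_ λ s → Face ([ octahedron , flat ] s) (triangleAt u x y)
    unique val (yes oct) = octahedron-unique val oct
    unique val (no ¬oct) = flat-unique′ (val , ¬oct)

  disjoint : VertexDisjoint octahedron
  disjoint i j i≢j u u∈i u∈j = i≢j (coset-unique {i} {j} {u} (octahedron-vertex i u∈i) (octahedron-vertex j u∈j))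

  private
    module Class₄ = DihedralClass 4

  octahedra-unique : Unique (Class₄.class p₀)
  octahedra-unique = Class₄.class-unique period-p₀ first-p₀-injective
    (from-yes (Fin.all? {n = 4} λ j → ¬? (next (next j) Fin.≟ j)))

  #flat≡ : k * (k ∸ 3) / 3 ≡ #flat
  #flat≡ = let a , b , ea , eb , e = #flat-count (Class₄.class p₀) octahedra-unique
                 (λ q∈ → let p₀∼q = Class₄.∈-class⁻ q∈ in valid-∼ valid-p₀ p₀∼q , octahedral-∼ p₀∼q)
                 (λ val oct → Class₄.∈-class⁺ period-p₀ (octahedral⇒∼ val oct)) in
    flat-count-octahedral 3≤k ea eb (trans (cong (_+ #flat * 12) (sym (Class₄.length-class p₀))) e)

  surfaces : ∃ (Surfaces k)
  surfaces = c + #flat , [ octahedron , flat ] ∘ splitAt c ,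
    DecomposesInto-reindex {K = skel₂β k} {S = [ octahedron , flat ]} (splitAt c) (join c #flat) (Fin.splitAt-join c #flat) (Fin.join-splitAt c #flat) decomposition ,
    λ i → surface (splitAt c i)
    where
    surface : ∀ s → IsClosedSurface ([ octahedron , flat ] s) × VertexTransitive ([ octahedron , flat ] s)
    surface (inj₁ i) = octahedron-surface i
    surface (inj₂ i) = proj₁ (flat-properties i) , proj₁ (proj₂ (flat-properties i))

  octahedra-and-flat-surfaces : OctahedraAndFlatSurfaces k c (k * (k ∸ 3) / 3)
  octahedra-and-flat-surfaces = subst (OctahedraAndFlatSurfaces k c) (sym #flat≡)
    (octahedron , flat , decomposition , disjoint , octahedron-properties , flat-properties)

theorem1p1 : (k : ℕ) → 3 ≤ k →
    (∃ λ (m : ℕ) → Σ (Fin m → SimplicialComplex (k + k)) λ S →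
    DecomposesInto (skel₂β k) S ×
    (∀ i → IsClosedSurface (S i) × VertexTransitive (S i)))
    ×
    (k % 3 ≡ 1 ⊎ k % 3 ≡ 2 →
    Σ (Fin (((k ∸ 1) * (k ∸ 2)) / 3) → SimplicialComplex (k + k)) λ S →
    DecomposesInto (skel₂β k) S ×
    (∀ i → IsClosedSurface (S i) × VertexTransitive (S i) ×
    χ (S i) ≡ 0ℤ × #vertices (S i) ≡ 2 * k))
    ×
    (k % 3 ≡ 0 →
    Σ (Fin (k / 3) → SimplicialComplex (k + k)) λ O →
    Σ (Fin ((k * (k ∸ 3)) / 3) → SimplicialComplex (k + k)) λ S →
    DecomposesInto (skel₂β k) [ O , S ] ×
    VertexDisjoint O ×
    (∀ i → (O i ≅ ∂β 3) × #vertices (O i) ≡ 6) ×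
    (∀ i → IsClosedSurface (S i) × VertexTransitive (S i) ×
    χ (S i) ≡ 0ℤ × #vertices (S i) ≡ 2 * k))
theorem1p1 k 3≤k = surfaces (k % 3) refl , flat-surfaces , octahedra-and-flat-surfaces
  where
  instance
    k+k≢0 : NonZero (k + k)
    k+k≢0 = ℕ.>-nonZero (ℕ.≤-trans (s≤s z≤n) (ℕ.≤-trans 3≤k (ℕ.m≤m+n k k)))
  3∤k : k % 3 ≡ 1 ⊎ k % 3 ≡ 2 → ¬ 3 ∣ k
  3∤k (inj₁ e) 3∣k = contradiction (trans (sym e) (n∣m⇒m%n≡0 k 3 3∣k)) λ ()
  3∤k (inj₂ e) 3∣k = contradiction (trans (sym e) (n∣m⇒m%n≡0 k 3 3∣k)) λ ()
  k≡3c : k % 3 ≡ 0 → k ≡ k / 3 * 3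
  k≡3c e = trans (m≡m%n+[m/n]*n k 3) (cong (_+ k / 3 * 3) e)
  flat-surfaces : k % 3 ≡ 1 ⊎ k % 3 ≡ 2 → FlatSurfaces k ((k ∸ 1) * (k ∸ 2) / 3)
  flat-surfaces e = NonMultipleOf3.flat-surfaces k 3≤k (3∤k e)
  octahedra-and-flat-surfaces : k % 3 ≡ 0 → OctahedraAndFlatSurfaces k (k / 3) (k * (k ∸ 3) / 3)
  octahedra-and-flat-surfaces e = MultipleOf3.octahedra-and-flat-surfaces k 3≤k (k / 3) (k≡3c e)
  surfaces : ∀ r → k % 3 ≡ r → ∃ (Surfaces k)
  surfaces 0 e = MultipleOf3.surfaces k 3≤k (k / 3) (k≡3c e)
  surfaces 1 e = _ , FlatSurfaces⇒Surfaces (flat-surfaces (inj₁ e))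
  surfaces 2 e = _ , FlatSurfaces⇒Surfaces (flat-surfaces (inj₂ e))
  surfaces (suc (suc (suc r))) e = contradiction (subst (_< 3) e (m%n<n k 3)) λ { (s≤s (s≤s (s≤s ()))) }
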